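{- Let $R$ be a valuation domain of cardinality $\aleph_1$ and $J/A$ a type with $J=\bigcup_{\nu<\omega_1} r_\nu^{ -1}R$ as in the context. If $\Gamma'_R(J/A)\neq 0$, then there is a non-standard uniserial $R$-module of type $J/A$.
   Context: $R$ is a valuation domain with quotient field $Q\neq R$ and unit group $R^*$. Uniserial: submodules totally ordered. For $R$-submodules $A\subseteq J$ of $Q$, $J/A$ is uniserial; a uniserial module is standard if isomorphic to such a $J/A$, non-standard otherwise. For uniserial $U$ and $0\ne a\in U$, $\mathrm{Ann}(a)=\{r:ra=0\}$, $D(a)=\bigcup\{r^{ -1}R: r\text{ divides }a\}$; $U$ has type $J/A$ if $J/A\cong D(a)/\mathrm{Ann}(a)$. Here $J=\bigcup_{\nu<\omega_1}r_\nu^{ -1}R$, $r_\nu\ne0$, $r_\mu\mid r_\nu$ for $\mu<\nu$. For a limit $\delta<\omega_1$ let $\mathcal T^\delta_{J/A}=\{\langle u_\sigma:\sigma<\delta\rangle: u_\sigma\in R^*,\ u_\tau-u_\sigma\in r_\sigma A \text{ for all }\sigma<\tau<\delta\}$. An $\omega_1$-filtration of $R$ by subrings is an increasing chain $\{N_\alpha:\alpha<\omega_1\}$ of countable subrings with $R=\bigcup_\alpha N_\alpha$, $N_\alpha=\bigcup_{\beta<\alpha}N_\beta$ for limit $\alpha$, $R^*\cap N_\alpha$ equal to the unit group of $N_\alpha$, and $r_\nu\in N_\alpha\iff\nu<\alpha$. Fixing such a filtration, let $E'=\{\delta<\omega_1\text{ limit}: \exists\langle u_\sigma:\sigma<\delta\rangle\in\mathcal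 T^\delta_{J/A}\ \forall f\in R^*\ \exists\sigma<\delta\ \ u_\sigma f\notin N_\delta+r_\sigma A\}$. Subsets of $\omega_1$ are equivalent if they agree on a closed unbounded set; $\tilde E$ denotes the class of $E$, and $0$ the class of sets disjoint from a cub. $\Gamma'_R(J/A)=\tilde{E'}$ (independent of the choices of $r_\nu$ and filtration). -}

module Defs where

open import Algebra.Bundles using (CommutativeMonoid; CommutativeRing)
open import Algebra.Definitions using (Invertible)
import Algebra.Definitions.RawMagma as Divisibility
open import Algebra.Module.Bundles using (Module)
open import Algebra.Module.Morphism.Structures using (module ModuleMorphisms)
open import Algebra.Module.Structures.Biased using (IsModuleFromLeft)
open import Algebra.Morphism.Structures using (module RingMorphisms)
import Algebra.Properties.AbelianGroup as AbelianGroupProperties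
import Algebra.Properties.CommutativeSemigroup as CommutativeSemigroupProperties
open import Data.Nat.Base using (ℕ)
open import Data.Product.Base using (Σ; Σ-syntax; ∃; ∃-syntax; _×_; _,_; proj₁; proj₂)
open import Data.Sum.Base using (_⊎_; inj₁; inj₂)
open import Function.Base using (flip)
open import Function.Bundles using (Injection; Bijection; _⇔_)
open import Induction.WellFounded using (WellFounded)
open import Level using (Level; suc; _⊔_)
open import Relation.Binary.Bundles using (Setoid)
import Relation.Binary.Construct.On as On
open import Relation.Binary.Core using (Rel)
open import Relation.Binary.Definitions using (_Respects_)
open import Relation.Binary.PropositionalEquality.Core using (_≡_)
import Relation.Binary.PropositionalEquality.Properties as ≡
import Relation.Binary.Reasoning.Setoid as SetoidReasoning
open import Relation.Binary.Structures using (IsStrictTotalOrder)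
open import Relation.Nullary.Negation.Core using (¬_)
open import Relation.Unary using (Pred; _⊆_; _≐_; _∩_; ∅; U)

------------------------------------------------------------------------
-- The ordinal ω₁

-- Countable means finite or countably infinite.
Countable : ∀ {c ℓ p} (S : Setoid c ℓ) → Pred (Setoid.Carrier S) p → Set (c ⊔ ℓ ⊔ p)
Countable S P = Injection (On.setoid S (proj₁ {B = P})) (≡.setoid ℕ)

-- ω₁ is characterised up to isomorphism as an uncountable well-order all of
-- whose proper initial segments are countable.
record Omega₁ (ℓ : Level) : Set (suc ℓ) where
  infix 4 _<_
  field
    Carrier            : Set ℓ
    _<_                : Rel Carrier ℓ
    isStrictTotalOrder : IsStrictTotalOrder _≡_ _<_
    wellFounded        : WellFounded _<_
    segmentCountable   : ∀ α → Countable (≡.setoid Carrier) (_< α)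
    uncountable        : ¬ Countable (≡.setoid Carrier) U

  setoid : Setoid ℓ ℓ
  setoid = ≡.setoid Carrier

  IsLimit : Pred Carrier ℓ
  IsLimit δ = (∃[ σ ] σ < δ) × (∀ σ → σ < δ → ∃[ τ ] (σ < τ × τ < δ))

  record IsCub (C : Pred Carrier ℓ) : Set ℓ where
    field
      unbounded : ∀ α → ∃[ β ] (α < β × C β)
      closed    : ∀ δ → IsLimit δ →
                  (∀ σ → σ < δ → ∃[ τ ] (σ < τ × τ < δ × C τ)) → C δ

  -- The class of a subset modulo the cub filter is its class under _∼_.
  infix 4 _∼_
  _∼_ : ∀ {p q} → Pred Carrier p → Pred Carrier q → Set (suc ℓ ⊔ p ⊔ q)
  E ∼ F = Σ[ C ∈ Pred Carrier ℓ ] (IsCub C × (E ∩ C) ≐ (F ∩ C))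

------------------------------------------------------------------------
-- Submodules, subquotients, uniserial modules

module _ {ℓ : Level} {R : CommutativeRing ℓ ℓ} where
  open CommutativeRing R using () renaming (Carrier to ∣R∣)

  record Submodule (M : Module R ℓ ℓ) : Set (suc ℓ) where
    open Module M
    field
      Member    : Pred Carrierᴹ ℓ
      resp      : Member Respects _≈ᴹ_
      0-closed  : Member 0ᴹ
      +-closed  : ∀ {x y} → Member x → Member y → Member (x +ᴹ y)
      *ₗ-closed : ∀ (r : ∣R∣) {x} → Member x → Member (r *ₗ x)

  open Submodule public using (Member)

  Uniserial : Module R ℓ ℓ → Set (suc ℓ)
  Uniserial M = (P P′ : Submodule M) → (Member P ⊆ Member P′) ⊎ (Member P′ ⊆ Member P)

  infix 4 _≅_
  _≅_ : Module R ℓ ℓ → Module R ℓ ℓ → Set ℓ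
  M ≅ M′ = ∃ (ModuleMorphisms.IsModuleIsomorphism (Module.rawModule M) (Module.rawModule M′))

  module _ (M : Module R ℓ ℓ) where
    open Module M
    private
      module R = CommutativeRing R
      module G = AbelianGroupProperties +ᴹ-abelianGroup
      module CS = CommutativeSemigroupProperties
        (CommutativeMonoid.commutativeSemigroup +ᴹ-commutativeMonoid)
      open SetoidReasoning ≈ᴹ-setoid

      *-neg : ∀ r x → r *ₗ (-ᴹ x) ≈ᴹ -ᴹ (r *ₗ x)
      *-neg r x = G.inverseʳ-unique _ _ (begin
        r *ₗ x +ᴹ r *ₗ (-ᴹ x) ≈⟨ *ₗ-distribˡ r x (-ᴹ x) ⟨
        r *ₗ (x +ᴹ (-ᴹ x))    ≈⟨ *ₗ-congˡ (-ᴹ‿inverseʳ x) ⟩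
        r *ₗ 0ᴹ               ≈⟨ *ₗ-zeroʳ r ⟩
        0ᴹ                    ∎)

      neg-* : ∀ x → (R.- R.1#) *ₗ x ≈ᴹ -ᴹ x
      neg-* x = G.inverseʳ-unique _ _ (begin
        x +ᴹ (R.- R.1#) *ₗ x          ≈⟨ +ᴹ-congʳ (*ₗ-identityˡ x) ⟨
        R.1# *ₗ x +ᴹ (R.- R.1#) *ₗ x  ≈⟨ *ₗ-distribʳ x R.1# (R.- R.1#) ⟨
        (R.1# R.+ (R.- R.1#)) *ₗ x    ≈⟨ *ₗ-congʳ (R.-‿inverseʳ R.1#) ⟩
        R.0# *ₗ x                     ≈⟨ *ₗ-zeroˡ x ⟩
        0ᴹ                            ∎)

    neg-closed : (P : Submodule M) → ∀ {x} → Member P x → Member P (-ᴹ x)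
    neg-closed P Px = Submodule.resp P (neg-* _) (Submodule.*ₗ-closed P (R.- R.1#) Px)

    -- The quotient P / N; N is meant to be contained in P (in general the
    -- construction yields P / (P ∩ N)).
    Subquotient : (P N : Submodule M) → Module R ℓ ℓ
    Subquotient P N = record
      { Carrierᴹ = Σ Carrierᴹ P.Member
      ; _≈ᴹ_     = _≈′_
      ; _+ᴹ_     = λ (x , Px) (y , Py) → x +ᴹ y , P.+-closed Px Py
      ; _*ₗ_     = _*′_
      ; _*ᵣ_     = flip _*′_
      ; 0ᴹ       = 0ᴹ , P.0-closed
      ; -ᴹ_      = λ (x , Px) → -ᴹ x , neg-closed P Px
      ; isModule = IsModuleFromLeft.isModule {commutativeRing = R} (record
        { isLeftModule = record
          { isLeftSemimodule = record
            { +ᴹ-isCommutativeMonoid = record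
              { isMonoid = record
                { isSemigroup = record
                  { isMagma = record
                    { isEquivalence = record
                      { refl  = ≈⇒∼ ≈ᴹ-refl
                      ; sym   = λ x∼y → N.resp (G.⁻¹-anti-homo‿- _ _) (neg-closed N x∼y)
                      ; trans = λ x∼y y∼z → N.resp telescope (N.+-closed x∼y y∼z)
                      }
                    ; ∙-cong = λ x∼y u∼v → N.resp interchange (N.+-closed x∼y u∼v)
                    }
                  ; assoc = λ _ _ _ → ≈⇒∼ (+ᴹ-assoc _ _ _)
                  }
                ; identity = (λ _ → ≈⇒∼ (+ᴹ-identityˡ _)) , (λ _ → ≈⇒∼ (+ᴹ-identityʳ _))
                }
              ; comm = λ _ _ → ≈⇒∼ (+ᴹ-comm _ _)
              }
            ; isPreleftSemimodule = record
              { *ₗ-cong      = λ {r} {s} r≈s x∼y → N.resp (scale r≈s) (N.*ₗ-closed r x∼y)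
              ; *ₗ-zeroˡ     = λ _ → ≈⇒∼ (*ₗ-zeroˡ _)
              ; *ₗ-distribʳ  = λ _ _ _ → ≈⇒∼ (*ₗ-distribʳ _ _ _)
              ; *ₗ-identityˡ = λ _ → ≈⇒∼ (*ₗ-identityˡ _)
              ; *ₗ-assoc     = λ _ _ _ → ≈⇒∼ (*ₗ-assoc _ _ _)
              ; *ₗ-zeroʳ     = λ _ → ≈⇒∼ (*ₗ-zeroʳ _)
              ; *ₗ-distribˡ  = λ _ _ _ → ≈⇒∼ (*ₗ-distribˡ _ _ _)
              }
            }
          ; -ᴹ‿cong    = λ x∼y → N.resp (≈ᴹ-sym (G.⁻¹-∙-comm _ _)) (neg-closed N x∼y)
          ; -ᴹ‿inverse = (λ _ → ≈⇒∼ (-ᴹ‿inverseˡ _)) , (λ _ → ≈⇒∼ (-ᴹ‿inverseʳ _))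
          }
        })
      }
      where
      module P = Submodule P
      module N = Submodule N

      _≈′_ : Rel (Σ Carrierᴹ P.Member) ℓ
      (x , _) ≈′ (y , _) = N.Member (x +ᴹ (-ᴹ y))

      _*′_ : ∣R∣ → Σ Carrierᴹ P.Member → Σ Carrierᴹ P.Member
      r *′ (x , Px) = r *ₗ x , P.*ₗ-closed r Px

      ≈⇒∼ : ∀ {x y} → x ≈ᴹ y → N.Member (x +ᴹ (-ᴹ y))
      ≈⇒∼ x≈y = N.resp (≈ᴹ-sym (G.x≈y⇒x∙y⁻¹≈ε x≈y)) N.0-closed

      telescope : ∀ {x y z} → (x +ᴹ (-ᴹ y)) +ᴹ (y +ᴹ (-ᴹ z)) ≈ᴹ x +ᴹ (-ᴹ z)
      telescope {x} {y} {z} = begin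
        (x +ᴹ (-ᴹ y)) +ᴹ (y +ᴹ (-ᴹ z)) ≈⟨ +ᴹ-assoc _ _ _ ⟩
        x +ᴹ ((-ᴹ y) +ᴹ (y +ᴹ (-ᴹ z))) ≈⟨ +ᴹ-congˡ (G.\\-leftDividesʳ y (-ᴹ z)) ⟩
        x +ᴹ (-ᴹ z)                    ∎

      interchange : ∀ {x y u v} →
        (x +ᴹ (-ᴹ y)) +ᴹ (u +ᴹ (-ᴹ v)) ≈ᴹ (x +ᴹ u) +ᴹ (-ᴹ (y +ᴹ v))
      interchange {x} {y} {u} {v} = begin
        (x +ᴹ (-ᴹ y)) +ᴹ (u +ᴹ (-ᴹ v)) ≈⟨ CS.interchange x (-ᴹ y) u (-ᴹ v) ⟩
        (x +ᴹ u) +ᴹ ((-ᴹ y) +ᴹ (-ᴹ v)) ≈⟨ +ᴹ-congˡ (G.⁻¹-∙-comm y v) ⟩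
        (x +ᴹ u) +ᴹ (-ᴹ (y +ᴹ v))      ∎

      scale : ∀ {r s x y} → r R.≈ s → r *ₗ (x +ᴹ (-ᴹ y)) ≈ᴹ r *ₗ x +ᴹ (-ᴹ (s *ₗ y))
      scale {r} {s} {x} {y} r≈s = begin
        r *ₗ (x +ᴹ (-ᴹ y))        ≈⟨ *ₗ-distribˡ r x (-ᴹ y) ⟩
        r *ₗ x +ᴹ r *ₗ (-ᴹ y)     ≈⟨ +ᴹ-congˡ (*-neg r y) ⟩
        r *ₗ x +ᴹ (-ᴹ (r *ₗ y))   ≈⟨ +ᴹ-congˡ (-ᴹ‿cong (*ₗ-congʳ r≈s)) ⟩
        r *ₗ x +ᴹ (-ᴹ (s *ₗ y))   ∎

------------------------------------------------------------------------
-- Valuation domains and quotient fields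

module _ {ℓ : Level} (R : CommutativeRing ℓ ℓ) where
  open CommutativeRing R

  Unit : Pred Carrier ℓ
  Unit = Invertible _≈_ 1# _*_

  record IsField : Set ℓ where
    field
      1≉0        : ¬ (1# ≈ 0#)
      invertible : ∀ x → ¬ (x ≈ 0#) → Unit x

  record IsSubring (N : Pred Carrier ℓ) : Set ℓ where
    field
      resp     : N Respects _≈_
      0-closed : N 0#
      1-closed : N 1#
      +-closed : ∀ {x y} → N x → N y → N (x + y)
      *-closed : ∀ {x y} → N x → N y → N (x * y)
      -‿closed : ∀ {x} → N x → N (- x)

  UnitIn : Pred Carrier ℓ → Pred Carrier ℓ
  UnitIn N x = N x × ∃[ y ] (N y × x * y ≈ 1#)

record ValuationDomain (ℓ : Level) : Set (suc ℓ) where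
  field
    commutativeRing : CommutativeRing ℓ ℓ
  open CommutativeRing commutativeRing public
  infix 4 _∣_
  _∣_ : Rel Carrier ℓ
  _∣_ = Divisibility._∣_ *-rawMagma
  field
    1≉0            : ¬ (1# ≈ 0#)
    noZeroDivisors : ∀ x y → x * y ≈ 0# → x ≈ 0# ⊎ y ≈ 0#
    ∣-total        : ∀ x y → x ∣ y ⊎ y ∣ x

record QuotientField {ℓ : Level} (V : ValuationDomain ℓ) : Set (suc ℓ) where
  private module R = ValuationDomain V
  field
    commutativeRing : CommutativeRing ℓ ℓ
  open CommutativeRing commutativeRing public
  field
    isField        : IsField commutativeRing
    ι              : R.Carrier → Carrier
    ι-monomorphism : RingMorphisms.IsRingMonomorphism R.rawRing rawRing ι
    fraction       : ∀ q → ∃[ a ] ∃[ b ] (¬ (b R.≈ R.0#) × ι b * q ≈ ι a)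

  open RingMorphisms.IsRingMonomorphism ι-monomorphism public
    renaming (⟦⟧-cong to ι-cong; injective to ι-injective)

  IsIntegral : Pred Carrier ℓ
  IsIntegral q = ∃[ s ] ι s ≈ q

  asModule : Module R.commutativeRing ℓ ℓ
  asModule = record
    { Carrierᴹ = Carrier
    ; _≈ᴹ_     = _≈_
    ; _+ᴹ_     = _+_
    ; _*ₗ_     = λ r q → ι r * q
    ; _*ᵣ_     = λ q r → ι r * q
    ; 0ᴹ       = 0#
    ; -ᴹ_      = -_
    ; isModule = IsModuleFromLeft.isModule {commutativeRing = R.commutativeRing} (record
      { isLeftModule = record
        { isLeftSemimodule = record
          { +ᴹ-isCommutativeMonoid = +-isCommutativeMonoid
          ; isPreleftSemimodule = record
            { *ₗ-cong      = λ r≈s x≈y → *-cong (ι-cong r≈s) x≈y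
            ; *ₗ-zeroˡ     = λ x → trans (*-congʳ 0#-homo) (zeroˡ x)
            ; *ₗ-distribʳ  = λ x r s → trans (*-congʳ (+-homo r s)) (distribʳ x (ι r) (ι s))
            ; *ₗ-identityˡ = λ x → trans (*-congʳ 1#-homo) (*-identityˡ x)
            ; *ₗ-assoc     = λ r s x → trans (*-congʳ (*-homo r s)) (*-assoc (ι r) (ι s) x)
            ; *ₗ-zeroʳ     = λ r → zeroʳ (ι r)
            ; *ₗ-distribˡ  = λ r x y → distribˡ (ι r) x y
            }
          }
        ; -ᴹ‿cong    = -‿cong
        ; -ᴹ‿inverse = -‿inverse
        }
      })
    }

------------------------------------------------------------------------
-- Standard modules and types

module Types {ℓ : Level} (V : ValuationDomain ℓ) (Q : QuotientField V) where
  private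
    module R = ValuationDomain V
    module Q = QuotientField Q
    open SetoidReasoning Q.setoid

  -- For r ≠ 0 this is r⁻¹R = { q ∈ Q : r q ∈ R }.
  infix 25 _⁻¹R
  _⁻¹R : R.Carrier → Pred Q.Carrier ℓ
  (r ⁻¹R) q = Q.IsIntegral (Q.ι r Q.* q)

  QSubmodule : Set (suc ℓ)
  QSubmodule = Submodule Q.asModule

  infix 20 _/_
  _/_ : (J A : QSubmodule) → Module R.commutativeRing ℓ ℓ
  J / A = Subquotient Q.asModule J A

  Standard : Module R.commutativeRing ℓ ℓ → Set (suc ℓ)
  Standard M = Σ[ J ∈ QSubmodule ] Σ[ A ∈ QSubmodule ] (Member A ⊆ Member J × M ≅ J / A)

  NonStandardUniserial : Module R.commutativeRing ℓ ℓ → Set (suc ℓ)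
  NonStandardUniserial M = Uniserial M × ¬ Standard M

  module _ (M : Module R.commutativeRing ℓ ℓ) where
    open Module M using (Carrierᴹ; _≈ᴹ_; 0ᴹ; _*ₗ_)
    private module M = Module M

    infix 4 _dividesᴹ_
    _dividesᴹ_ : R.Carrier → Carrierᴹ → Set ℓ
    r dividesᴹ a = ∃[ b ] r *ₗ b ≈ᴹ a

    -- Ann(a), viewed inside Q.
    Ann : Carrierᴹ → QSubmodule
    Ann a = record
      { Member    = λ q → ∃[ r ] (r *ₗ a ≈ᴹ 0ᴹ × Q.ι r Q.≈ q)
      ; resp      = λ p≈q (r , ra≈0 , r≈p) → r , ra≈0 , Q.trans r≈p p≈q
      ; 0-closed  = R.0# , M.*ₗ-zeroˡ a , Q.0#-homo
      ; +-closed  = λ (r , ra≈0 , r≈p) (s , sa≈0 , s≈q) →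
          r R.+ s
        , M.≈ᴹ-trans (M.*ₗ-distribʳ a r s)
            (M.≈ᴹ-trans (M.+ᴹ-cong ra≈0 sa≈0) (M.+ᴹ-identityˡ 0ᴹ))
        , Q.trans (Q.+-homo r s) (Q.+-cong r≈p s≈q)
      ; *ₗ-closed = λ t (r , ra≈0 , r≈p) →
          t R.* r
        , M.≈ᴹ-trans (M.*ₗ-assoc t r a)
            (M.≈ᴹ-trans (M.*ₗ-congˡ ra≈0) (M.*ₗ-zeroʳ t))
        , Q.trans (Q.*-homo t r) (Q.*-congˡ r≈p)
      }

    D : Carrierᴹ → QSubmodule
    D a = record
      { Member    = In
      ; resp      = λ p≈q (r , r≉0 , r∣a , s , s≈rp) →
          r , r≉0 , r∣a , s , Q.trans s≈rp (Q.*-congˡ p≈q)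
      ; 0-closed  = R.1# , R.1≉0 , (a , M.*ₗ-identityˡ a)
                  , R.0# , Q.trans Q.0#-homo (Q.sym (Q.zeroʳ _))
      ; +-closed  = λ {p} {q} (r , r≉0 , r∣a , pᵣ) (r′ , r′≉0 , r′∣a , qᵣ′) → add p q r r′
                      r≉0 r∣a pᵣ r′≉0 r′∣a qᵣ′ (R.∣-total r r′)
      ; *ₗ-closed = λ t (r , r≉0 , r∣a , s , s≈rp) →
          r , r≉0 , r∣a , t R.* s , (begin
            Q.ι (t R.* s)              ≈⟨ Q.*-homo t s ⟩
            Q.ι t Q.* Q.ι s            ≈⟨ Q.*-congˡ s≈rp ⟩
            Q.ι t Q.* (Q.ι r Q.* _)    ≈⟨ x∙yz≈y∙xz _ _ _ ⟩
            Q.ι r Q.* (Q.ι t Q.* _)    ∎)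
      }
      where
      open CommutativeSemigroupProperties Q.*-commutativeSemigroup using (x∙yz≈y∙xz)

      In : Pred Q.Carrier ℓ
      In q = ∃[ r ] (¬ (r R.≈ R.0#) × r dividesᴹ a × (r ⁻¹R) q)

      -- r ∣ r′ implies r⁻¹R ⊆ r′⁻¹R
      enlarge : ∀ {r r′ q} → r R.∣ r′ → (r ⁻¹R) q → (r′ ⁻¹R) q
      enlarge {r} {r′} {q} (t Divisibility., tr≈r′) (s , s≈rq) = t R.* s , (begin
        Q.ι (t R.* s)            ≈⟨ Q.*-homo t s ⟩
        Q.ι t Q.* Q.ι s          ≈⟨ Q.*-congˡ s≈rq ⟩
        Q.ι t Q.* (Q.ι r Q.* q)  ≈⟨ Q.*-assoc _ _ _ ⟨
        Q.ι t Q.* Q.ι r Q.* q    ≈⟨ Q.*-congʳ (Q.*-homo t r) ⟨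
        Q.ι (t R.* r) Q.* q      ≈⟨ Q.*-congʳ (Q.ι-cong tr≈r′) ⟩
        Q.ι r′ Q.* q             ∎)

      sum : ∀ {r p q} → (r ⁻¹R) p → (r ⁻¹R) q → (r ⁻¹R) (p Q.+ q)
      sum {r} {p} {q} (s , s≈rp) (t , t≈rq) = s R.+ t , (begin
        Q.ι (s R.+ t)                  ≈⟨ Q.+-homo s t ⟩
        Q.ι s Q.+ Q.ι t                ≈⟨ Q.+-cong s≈rp t≈rq ⟩
        Q.ι r Q.* p Q.+ Q.ι r Q.* q    ≈⟨ Q.distribˡ _ _ _ ⟨
        Q.ι r Q.* (p Q.+ q)            ∎)

      add : ∀ p q r r′ → ¬ (r R.≈ R.0#) → r dividesᴹ a → (r ⁻¹R) p →
            ¬ (r′ R.≈ R.0#) → r′ dividesᴹ a → (r′ ⁻¹R) q →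
            r R.∣ r′ ⊎ r′ R.∣ r → In (p Q.+ q)
      add p q r r′ _ _ pᵣ r′≉0 r′∣a qᵣ′ (inj₁ r∣r′) =
        r′ , r′≉0 , r′∣a , sum (enlarge r∣r′ pᵣ) qᵣ′
      add p q r r′ r≉0 r∣a pᵣ _ _ qᵣ′ (inj₂ r′∣r) =
        r , r≉0 , r∣a , sum pᵣ (enlarge r′∣r qᵣ′)

    -- For uniserial M the isomorphism class of D(a) / Ann(a) does not depend
    -- on the choice of a ≠ 0.
    HasType : (J A : QSubmodule) → Set ℓ
    HasType J A = ∃[ a ] (¬ (a ≈ᴹ 0ᴹ) × J / A ≅ D a / Ann a)

------------------------------------------------------------------------
-- The invariant Γ′

module Gamma {ℓ : Level} (ω₁ : Omega₁ ℓ) (V : ValuationDomain ℓ) (Q : QuotientField V) where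
  open Types V Q
  private
    module Ω = Omega₁ ω₁
    module R = ValuationDomain V
    module Q = QuotientField Q
  open Ω using (_<_; IsLimit)

  record IsChainFor (J : QSubmodule) (r : Ω.Carrier → R.Carrier) : Set ℓ where
    field
      nonzero    : ∀ ν → ¬ (r ν R.≈ R.0#)
      increasing : ∀ {μ ν} → μ < ν → r μ R.∣ r ν
      exhausts   : Member J ≐ λ q → ∃[ ν ] (r ν ⁻¹R) q

  record IsFiltration (r : Ω.Carrier → R.Carrier)
                      (N : Ω.Carrier → Pred R.Carrier ℓ) : Set ℓ where
    field
      subring    : ∀ α → IsSubring R.commutativeRing (N α)
      countable  : ∀ α → Countable R.setoid (N α)
      increasing : ∀ {α β} → α < β → N α ⊆ N β
      exhausts   : ∀ x → ∃[ α ] N α x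
      continuous : ∀ δ → IsLimit δ → N δ ≐ λ x → ∃[ β ] (β < δ × N β x)
      units      : ∀ α → (Unit R.commutativeRing ∩ N α) ≐ UnitIn R.commutativeRing (N α)
      separates  : ∀ ν α → N α (r ν) ⇔ ν < α

  module _ (A : QSubmodule) (r : Ω.Carrier → R.Carrier) where

    Scaled : Ω.Carrier → Pred Q.Carrier ℓ
    Scaled σ q = ∃[ a ] (Member A a × q Q.≈ Q.ι (r σ) Q.* a)

    -- A sequence of length δ is represented by a function on all of ω₁ of
    -- which only the values below δ matter.
    𝒯 : Ω.Carrier → Pred (Ω.Carrier → R.Carrier) ℓ
    𝒯 δ u = (∀ σ → σ < δ → Unit R.commutativeRing (u σ))
          × (∀ σ τ → σ < τ → τ < δ → Scaled σ (Q.ι (u τ R.- u σ)))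

    module _ (N : Ω.Carrier → Pred R.Carrier ℓ) where

      infix 5 _+Scaled_
      _+Scaled_ : Ω.Carrier → Ω.Carrier → Pred Q.Carrier ℓ
      (δ +Scaled σ) q = ∃[ n ] ∃[ b ] (N δ n × Scaled σ b × q Q.≈ Q.ι n Q.+ b)

      E′ : Pred Ω.Carrier ℓ
      E′ δ = IsLimit δ × (∃[ u ] (𝒯 δ u × (∀ f → Unit R.commutativeRing f →
               ∃[ σ ] (σ < δ × ¬ (δ +Scaled σ) (Q.ι (u σ R.* f))))))

      Γ′≢0 : Set (suc ℓ)
      Γ′≢0 = ¬ (E′ Ω.∼ ∅)

{-# OPTIONS --safe #-}
module Submission where

-- Units e δ σ (σ < δ) with e δ σ ≡ e δ τ · e τ σ mod r σ A glue the modules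
-- (r σ)⁻¹R / A into a uniserial module of type J/A, which is standard only if there are
-- units f δ with e δ σ · f δ ≡ f σ mod r σ A. The rows e δ are constructed by recursion on δ.
-- Since δ is countable some extension c of the earlier rows exists, and c u is another one
-- for every u ∈ 𝒯 δ. If δ ∈ E′ is witnessed by u, then at least one of c and c u escapes, that is,
-- no unit f puts all c σ · f (respectively c σ · u σ · f) into N δ + r σ A: if f works for c and f′
-- for c u, then f′ f⁻¹ works for u. On a cub of δ the elements f σ (σ < δ) lie in N δ,
-- so at such a δ ∈ E′ the unit f δ would contradict the escape of e δ.

open import Defs
open import Algebra.Bundles using (AbelianGroup; CommutativeMonoid; CommutativeRing)
import Algebra.Construct.NaturalChoice.Max as Max
import Algebra.Definitions as AlgebraDefinitions
import Algebra.Definitions.RawMagma as Divisibility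
open import Algebra.Module.Bundles using (Module)
open import Algebra.Module.Morphism.Structures using (module ModuleMorphisms)
open import Algebra.Module.Structures.Biased using (IsModuleFromLeft)
import Algebra.Properties.AbelianGroup as AbelianGroupProperties
import Algebra.Properties.CommutativeSemigroup as CommutativeSemigroupProperties
import Algebra.Properties.Monoid.Divisibility as MonoidDivisibility
import Algebra.Properties.Ring as RingProperties
import Algebra.Solver.Ring.NaturalCoefficients.Default as RingSolver
open import Axiom.ExcludedMiddle using (ExcludedMiddle)
open import Data.Nat.Base as ℕ using (ℕ; zero; suc)
open import Data.Nat.GeneralisedArithmetic using (fold)
import Data.Nat.Properties as ℕ
open import Data.Product.Base using (Σ-syntax; ∃; ∃-syntax; _×_; _,_; proj₁; proj₂)
open import Data.Sum.Base as Sum using (_⊎_; inj₁; inj₂; [_,_]′)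
open import Data.Unit.Polymorphic.Base using (⊤; tt)
open import Function.Base using (const; id)
open import Function.Bundles using (Bijection; Injection)
open import Induction.WellFounded using (Acc; acc; module All)
open import Level using (Level)
open import Relation.Binary.Bundles using (Setoid; TotalOrder)
import Relation.Binary.Construct.On as On
import Relation.Binary.Construct.StrictToNonStrict as ToNonStrict
open import Relation.Binary.Definitions using (tri<; tri≈; tri>)
open import Relation.Binary.PropositionalEquality as ≡ using (_≡_)
import Relation.Binary.Reasoning.Setoid as SetoidReasoning
open import Relation.Binary.Structures using (IsEquivalence; IsStrictTotalOrder)
open import Relation.Nullary.Decidable.Core using (Dec; yes; no; decidable-stable)
open import Relation.Nullary.Negation.Core using (¬_; contradiction)
open import Relation.Unary using (Pred; _⊆_; _≐_; ∅)

-- Countable ordinals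

-- Extending a row uses only countable cofinality: along an ω-sequence cofinal in δ, values are
-- chosen one after another, each by a division in the unit group, and all rungs above σ then agree
-- modulo `r σ A`. This argument stops at length ω₁, which leaves room for non-standardness.
-- Dividing f′ by f is the delicate point, because `N δ` is only a subring. If `r σ A` lies in the
-- maximal ideal, an element n of `N δ` congruent to `c σ · f` is a unit of R, and the filtration
-- puts its inverse into `N δ`. Otherwise `r σ A` contains R and everything is captured at σ. A
-- fixed ν with `r⁻¹ ν` outside `A` marks a level of the first kind; it also provides the non-zero
-- element at which the type is computed and the level at which an isomorphism is normalised. The
-- direct limit is realised inside the functions from ω₁ to Q modulo those eventually in `A`, so
-- that its relations can be checked pointwise at large arguments.

pair : ℕ → ℕ → ℕ
pair zero    b = suc (2 ℕ.* b)
pair (suc a) b = 2 ℕ.* pair a b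

-- `pair a b` is 2^a (2b + 1): parity decides whether `a` is zero, and halving lowers it.
pair-injective : ∀ a b a′ b′ → pair a b ≡ pair a′ b′ → a ≡ a′ × b ≡ b′
pair-injective zero    b zero     b′ eq = ≡.refl , ℕ.*-cancelˡ-≡ b b′ 2 (ℕ.suc-injective eq)
pair-injective zero    b (suc a′) b′ eq = contradiction (≡.sym eq) (ℕ.even≢odd (pair a′ b′) b)
pair-injective (suc a) b zero     b′ eq = contradiction eq (ℕ.even≢odd (pair a b) b′)
pair-injective (suc a) b (suc a′) b′ eq
  with ≡.refl , ≡.refl ← pair-injective a b a′ b′ (ℕ.*-cancelˡ-≡ _ _ 2 eq) = ≡.refl , ≡.refl

module Ordinals (em : ∀ {a} → ExcludedMiddle a) {ℓ : Level} (ω₁ : Omega₁ ℓ) where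
  open Omega₁ ω₁
  open IsStrictTotalOrder isStrictTotalOrder public
    using (compare; _<?_) renaming (trans to <-trans; irrefl to <-irrefl)
  open ToNonStrict _≡_ _<_ public using (_≤_)

  ≤-totalOrder : TotalOrder ℓ ℓ ℓ
  ≤-totalOrder = record
    { isTotalOrder = ToNonStrict.isTotalOrder _≡_ _<_ isStrictTotalOrder }

  open TotalOrder ≤-totalOrder public using () renaming (refl to ≤-refl; trans to ≤-trans)
  open Max ≤-totalOrder public using (_⊔_; x≤x⊔y; x≤y⊔x; ⊔-lub)

  ≤-<-trans : ∀ {σ τ ρ} → σ ≤ τ → τ < ρ → σ < ρ
  ≤-<-trans = ToNonStrict.≤-<-trans _≡_ _<_ ≡.sym <-trans (λ { ≡.refl σ<τ → σ<τ })

  ≮⇒≥ : ∀ {σ τ} → ¬ σ < τ → τ ≤ σ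
  ≮⇒≥ {σ} {τ} σ≮τ with compare σ τ
  ... | tri< σ<τ _ _ = contradiction σ<τ σ≮τ
  ... | tri≈ _ σ≡τ _ = inj₂ (≡.sym σ≡τ)
  ... | tri> _ _ τ<σ = inj₁ τ<σ

  ⊔-< : ∀ {σ τ ρ} → σ < ρ → τ < ρ → σ ⊔ τ < ρ
  ⊔-< {σ} {τ} σ<ρ τ<ρ with TotalOrder.total ≤-totalOrder σ τ
  ... | inj₁ σ≤τ = ≤-<-trans (⊔-lub σ≤τ ≤-refl) τ<ρ
  ... | inj₂ τ≤σ = ≤-<-trans (⊔-lub ≤-refl τ≤σ) σ<ρ

  least : (P : Pred Carrier ℓ) → ∃ P → ∃[ μ ] P μ × ∀ σ → P σ → μ ≤ σ
  least P (α , Pα) = decidable-stable em λ none →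
    All.wfRec wellFounded ℓ (λ σ → ¬ P σ)
      (λ σ below Pσ → none (σ , Pσ , λ τ Pτ → ≮⇒≥ λ τ<σ → below τ<σ Pτ)) α Pα

  private
    -- Zero is reserved for β = γ, since `segmentCountable` numbers only the strict predecessors.
    code : ∀ γ β → β ≤ γ → ℕ
    code γ β (inj₁ β<γ) = suc (Injection.to (segmentCountable γ) (β , β<γ))
    code γ β (inj₂ _)   = zero

    code-injective : ∀ {γ γ′ β β′} (p : β ≤ γ) (p′ : β′ ≤ γ′) →
                     γ ≡ γ′ → code γ β p ≡ code γ′ β′ p′ → β ≡ β′
    code-injective {γ} (inj₁ _) (inj₁ _) ≡.refl eq =
      Injection.injective (segmentCountable γ) (ℕ.suc-injective eq)
    code-injective (inj₂ ≡.refl) (inj₂ ≡.refl) ≡.refl _ = ≡.refl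

  -- Otherwise ω₁ would be the union of the countable segments up to the `s n`; pairing `n` with a
  -- code inside its segment would inject ω₁ into ℕ.
  sequence-bounded : (s : ℕ → Carrier) → ∃[ β ] ∀ n → s n < β
  sequence-bounded s = decidable-stable em λ unbounded →
    let cover : ∀ β → ∃[ n ] β ≤ s n
        cover β = decidable-stable em λ none →
          unbounded (β , λ n → decidable-stable em λ sn≮β → none (n , ≮⇒≥ sn≮β))
    in uncountable record
      { to        = λ (β , _) → let n , p = cover β in pair n (code (s n) β p)
      ; cong      = λ { ≡.refl → ≡.refl }
      ; injective = λ { {β , _} {β′ , _} eq →
          let n , p = cover β ; n′ , p′ = cover β′
              n≡n′ , eq′ = pair-injective n (code (s n) β p) n′ (code (s n′) β′ p′) eq
          in code-injective p p′ (≡.cong s n≡n′) eq′ }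
      }

  -- The default value keeps the enumeration total when γ is the least element.
  enumeration : ∀ γ default → Σ[ s ∈ (ℕ → Carrier) ]
    (∀ n → s n < γ ⊎ s n ≡ default) × (∀ σ → σ < γ → ∃[ n ] s n ≡ σ)
  enumeration γ default = (λ n → value n em) , (λ n → range n em) , surj
    where
    index : ∀ σ → σ < γ → ℕ
    index σ σ<γ = Injection.to (segmentCountable γ) (σ , σ<γ)

    Hit : ℕ → Set ℓ
    Hit n = ∃[ σ ] Σ[ σ<γ ∈ σ < γ ] index σ σ<γ ≡ n

    value : ∀ n → Dec (Hit n) → Carrier
    value n (yes (σ , _)) = σ
    value n (no _)        = default

    range : ∀ n d → value n d < γ ⊎ value n d ≡ default
    range n (yes (_ , σ<γ , _)) = inj₁ σ<γ
    range n (no _)              = inj₂ ≡.refl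

    hits : ∀ σ (σ<γ : σ < γ) d → value (index σ σ<γ) d ≡ σ
    hits σ σ<γ (yes (_ , _ , eq)) = Injection.injective (segmentCountable γ) eq
    hits σ σ<γ (no none)          = contradiction (σ , σ<γ , ≡.refl) none

    surj : ∀ σ → σ < γ → ∃[ n ] value n em ≡ σ
    surj σ σ<γ = index σ σ<γ , hits σ σ<γ em

  image-bounded : (h : Carrier → Carrier) → ∀ γ → ∃[ β ] γ < β × ∀ σ → σ < γ → h σ < β
  image-bounded h γ =
    let s , _ , surj = enumeration γ γ
        -- Joining with γ makes the bound exceed γ even when nothing lies below γ.
        β , bound    = sequence-bounded (λ n → γ ⊔ h (s n))
    in β , ≤-<-trans (x≤x⊔y γ _) (bound 0) , λ σ σ<γ →
         let n , sn≡σ = surj σ σ<γ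
         in ≡.subst (λ τ → h τ < β) sn≡σ (≤-<-trans (x≤y⊔x γ (h (s n))) (bound n))

  runningMax : (ℕ → Carrier) → ℕ → Carrier
  runningMax s zero    = s zero
  runningMax s (suc n) = runningMax s n ⊔ s (suc n)

  ≤-runningMax : ∀ s n → s n ≤ runningMax s n
  ≤-runningMax s zero    = ≤-refl
  ≤-runningMax s (suc n) = x≤y⊔x (runningMax s n) (s (suc n))

  runningMax-< : ∀ s {δ} → (∀ n → s n < δ) → ∀ n → runningMax s n < δ
  runningMax-< s s<δ zero    = s<δ zero
  runningMax-< s s<δ (suc n) = ⊔-< (runningMax-< s s<δ n) (s<δ (suc n))

  -- Weak monotonicity lets one notion serve successors, where rungs become constant, as well as
  -- limits. The premise of `below` accommodates the least ordinal, which has nothing below it.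
  record Ladder (δ : Carrier) : Set ℓ where
    field
      rung      : ℕ → Carrier
      monotone  : ∀ n → rung n ≤ rung (suc n)
      below     : ∀ {σ} → σ < δ → ∀ n → rung n < δ
      cofinal   : ∀ σ → σ < δ → ∃[ n ] σ ≤ rung n

  ladder : ∀ δ → Ladder δ
  ladder δ with em {P = ∃[ σ ] σ < δ}
  ... | no none = record
    { rung     = const δ
    ; monotone = λ _ → ≤-refl
    ; below    = λ σ<δ → contradiction (_ , σ<δ) none
    ; cofinal  = λ σ σ<δ → contradiction (σ , σ<δ) none
    }
  ... | yes (α , α<δ) = let s , range , surj = enumeration δ α in record
    { rung     = runningMax s
    ; monotone = λ n → x≤x⊔y (runningMax s n) (s (suc n))
    ; below    = λ _ → runningMax-< s λ n →
        [ id , (λ sn≡α → ≡.subst (_< δ) (≡.sym sn≡α) α<δ) ]′ (range n)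
    ; cofinal  = λ σ σ<δ →
        let n , sn≡σ = surj σ σ<δ
        in n , ≡.subst (_≤ runningMax s n) sn≡σ (≤-runningMax s n)
    }

  closureCub : (h : Carrier → Carrier) → IsCub (λ δ → ∀ σ → σ < δ → h σ < δ)
  closureCub h = record
    { unbounded = λ α →
        let next = λ γ → proj₁ (image-bounded h γ)
            b : ℕ → Carrier
            b = fold α next
            β , b<β , β-least = least (λ β → ∀ n → b n < β) (sequence-bounded b)
        in β , b<β 0 , λ σ σ<β →
             -- As β is the least strict bound, σ does not bound the sequence: σ ≤ `b n` for some n,
             -- hence `h σ` lies below `b (n + 2)`.
             let n , bn≮σ = decidable-stable em λ none →
                   contradiction (≤-<-trans (β-least σ
                      λ n → decidable-stable em λ bn≮σ → none (n , bn≮σ)) σ<β)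
                                 (<-irrefl ≡.refl)
                 _ , γ<next , _ = image-bounded h (b n)
                 _ , _ , h<next = image-bounded h (b (suc n))
             in <-trans (h<next σ (≤-<-trans (≮⇒≥ bn≮σ) γ<next)) (b<β (suc (suc n)))
    ; closed = λ δ _ limit σ σ<δ →
        let τ , σ<τ , τ<δ , closedτ = limit σ σ<δ in <-trans (closedτ σ σ<τ) τ<δ
    }

  -- A cub disjoint from `E` would itself witness `E ∼ ∅`.
  stationary : ∀ {p} {E : Pred Carrier p} → ¬ (E ∼ ∅) →
               ∀ {C} → IsCub C → ∃[ δ ] E δ × C δ
  stationary E≁∅ {C} cub = decidable-stable em λ disjoint →
    E≁∅ (C , cub , (λ (Eδ , Cδ) → contradiction (_ , Eδ , Cδ) disjoint) , λ ())

  unbounded : ∀ α → ∃[ β ] α < β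
  unbounded α = let β , α<β , _ = image-bounded (λ σ → σ) α in β , α<β

-- Coherent systems of group elements

module CoherentSystem (em : ∀ {a} → ExcludedMiddle a) {ℓ : Level} (ω₁ : Omega₁ ℓ)
  (G : AbelianGroup ℓ ℓ) where
  open Omega₁ ω₁ using (_<_) renaming (Carrier to Ω)
  open Ordinals em ω₁
  open AbelianGroup G
  open CommutativeSemigroupProperties (CommutativeMonoid.commutativeSemigroup commutativeMonoid)
    using (xy∙z≈xz∙y)
  open AbelianGroupProperties G using (//-rightDividesˡ)

  -- The intended instance has the units of R as group, congruence modulo `r σ A` as `_∼[ σ ]_`,
  -- escape as `P`, and a member of `𝒯 δ` as `w δ`.
  module Rows
    (_∼[_]_ : Carrier → Ω → Carrier → Set ℓ)
    (∼-isEquivalence : ∀ σ → IsEquivalence (_∼[ σ ]_))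
    (∼-∙-cong : ∀ σ → AlgebraDefinitions.Congruent₂ (_∼[ σ ]_) _∙_)
    (∼-reflexive : ∀ σ {x y} → x ≈ y → x ∼[ σ ] y)
    (∼-antitone : ∀ {σ τ} → σ < τ → ∀ {x y} → x ∼[ τ ] y → x ∼[ σ ] y)
    (P : Ω → Pred (Ω → Carrier) ℓ)
    (P-resp : ∀ δ {x y} → (∀ σ → σ < δ → x σ ≈ y σ) → P δ x → P δ y)
    (w : Ω → Ω → Carrier)
    (w-coherent : ∀ δ {σ τ} → σ < τ → τ < δ → w δ σ ∼[ σ ] w δ τ)
    (w-corrects : ∀ δ x → ¬ P δ x → P δ (λ σ → x σ ∙ w δ σ))
    where

    private
      module ∼ (σ : Ω) = IsEquivalence (∼-isEquivalence σ)

      ∼-setoid : Ω → Setoid ℓ ℓ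
      ∼-setoid σ = record { isEquivalence = ∼-isEquivalence σ }

      ∼-antitone-≤ : ∀ {σ τ} → σ ≤ τ → ∀ {x y} → x ∼[ τ ] y → x ∼[ σ ] y
      ∼-antitone-≤ (inj₁ σ<τ)   = ∼-antitone σ<τ
      ∼-antitone-≤ (inj₂ ≡.refl) x∼y = x∼y

      System : Set ℓ
      System = Ω → Ω → Carrier

      Coherent : System → Pred Ω ℓ
      Coherent S δ = ∀ {σ τ} → σ ≤ τ → τ ≤ δ → S δ σ ∼[ σ ] (S δ τ ∙ S τ σ)

      module L (δ : Ω) = Ladder (ladder δ)

      level : ∀ δ σ → Dec (∃[ n ] σ ≤ L.rung δ n) → ℕ
      level δ σ (yes (n , _)) = n
      level δ σ (no _)        = 0

      level-bound : ∀ δ {σ} → σ < δ → ∀ d → σ ≤ L.rung δ (level δ σ d)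
      level-bound δ σ<δ (yes (_ , p)) = p
      level-bound δ σ<δ (no none)     = contradiction (L.cofinal δ _ σ<δ) none

      -- The value of the uncorrected row at rung n. Coherence asks that the value at rung n be the
      -- value at rung n + 1 times the entry between the two, so each new value is a quotient; the
      -- value `ε` at rung 0 is a free choice.
      base : Ω → System → ℕ → Carrier
      base δ S zero    = ε
      base δ S (suc n) = base δ S n ∙ (S (L.rung δ (suc n)) (L.rung δ n)) ⁻¹

      atLevel : Ω → System → ℕ → Ω → Carrier
      atLevel δ S n σ = base δ S n ∙ S (L.rung δ n) σ

      extend : Ω → System → Ω → Carrier
      extend δ S σ = atLevel δ S (level δ σ em) σ

      -- The decision is an argument because `em` does not reduce: facts are proved for both answers
      -- and then applied to `em`.
      correction : ∀ δ (x : Ω → Carrier) → Dec (P δ x) → Ω → Carrier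
      correction δ x (yes _) σ = ε
      correction δ x (no _)  σ = w δ σ

      corrected : Ω → System → Ω → Carrier
      corrected δ S σ = extend δ S σ ∙ correction δ (extend δ S) em σ

      step : Ω → System → Ω → Carrier
      step δ S σ with σ <? δ
      ... | yes _ = corrected δ S σ
      -- The diagonal σ = δ falls under this default, which yields `e-refl`.
      ... | no  _ = ε

      module _ (δ : Ω) {S S′ : System} (S≈S′ : ∀ τ σ → S τ σ ≈ S′ τ σ) where
        base-cong : ∀ n → base δ S n ≈ base δ S′ n
        base-cong zero    = refl
        base-cong (suc n) = ∙-cong (base-cong n) (⁻¹-cong (S≈S′ _ _))

        extend-cong : ∀ σ → extend δ S σ ≈ extend δ S′ σ
        extend-cong σ = ∙-cong (base-cong (level δ σ em)) (S≈S′ _ _)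

        step-cong : ∀ σ → step δ S σ ≈ step δ S′ σ
        step-cong σ with σ <? δ
        ... | no  _ = refl
        ... | yes _ = ∙-cong (extend-cong σ) (correction-cong em em)
          where
          correction-cong : ∀ d d′ → correction δ (extend δ S) d σ ≈ correction δ (extend δ S′) d′ σ
          correction-cong (yes _)  (yes _)   = refl
          correction-cong (no _)   (no _)    = refl
          -- `em` decides two different propositions here; `P-resp` rules out diverging answers.
          correction-cong (yes Px) (no ¬Px′) =
            contradiction (P-resp δ (λ τ _ → extend-cong τ) Px) ¬Px′
          correction-cong (no ¬Px) (yes Px′) =
            contradiction (P-resp δ (λ τ _ → sym (extend-cong τ)) Px′) ¬Px

      module _ (δ : Ω) {S : System} (coherent : ∀ {ρ} → ρ < δ → Coherent S ρ) where

        -- Coherence of the row at rung n + 1 splits off exactly the factor by which `base` was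
        -- divided.
        atLevel-suc : ∀ {σ} → σ < δ → ∀ n → σ ≤ L.rung δ n →
                      atLevel δ S (suc n) σ ∼[ σ ] atLevel δ S n σ
        atLevel-suc {σ} σ<δ n σ≤sₙ = begin
          (b ∙ t ⁻¹) ∙ S (L.rung δ (suc n)) σ
            ≈⟨ ∼-∙-cong σ (∼.refl σ) (coherent (L.below δ σ<δ (suc n)) σ≤sₙ (L.monotone δ n)) ⟩
          (b ∙ t ⁻¹) ∙ (t ∙ S (L.rung δ n) σ)
            ≈⟨ ∼-reflexive σ (trans (sym (assoc _ _ _)) (∙-congʳ (//-rightDividesˡ t b))) ⟩
          b ∙ S (L.rung δ n) σ ∎
          where
          open SetoidReasoning (∼-setoid σ)
          b = base δ S n
          t = S (L.rung δ (suc n)) (L.rung δ n)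

        rung-mono : ∀ n k → L.rung δ n ≤ L.rung δ (k ℕ.+ n)
        rung-mono n zero    = ≤-refl
        rung-mono n (suc k) = ≤-trans (rung-mono n k) (L.monotone δ (k ℕ.+ n))

        atLevel-+ : ∀ {σ} → σ < δ → ∀ n k → σ ≤ L.rung δ n →
                    atLevel δ S (k ℕ.+ n) σ ∼[ σ ] atLevel δ S n σ
        atLevel-+ σ<δ n zero    σ≤sₙ = ∼.refl _
        atLevel-+ σ<δ n (suc k) σ≤sₙ = ∼.trans _
          (atLevel-suc σ<δ (k ℕ.+ n) (≤-trans σ≤sₙ (rung-mono n k)))
          (atLevel-+ σ<δ n k σ≤sₙ)

        -- The levels chosen for σ and τ are unrelated, so both are moved up to their sum, where
        -- coherence of one earlier row compares σ with τ.
        extend-coherent : ∀ {σ τ} → σ ≤ τ → τ < δ → extend δ S σ ∼[ σ ] (extend δ S τ ∙ S τ σ)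
        extend-coherent {σ} {τ} σ≤τ τ<δ = begin
          atLevel δ S n σ
            ≈⟨ atLevel-+ σ<δ n m (level-bound δ σ<δ em) ⟨
          base δ S k ∙ S (L.rung δ k) σ
            ≈⟨ ∼-∙-cong σ (∼.refl σ) (coherent (L.below δ σ<δ k) σ≤τ τ≤sₖ) ⟩
          base δ S k ∙ (S (L.rung δ k) τ ∙ S τ σ)
            ≈⟨ ∼-reflexive σ (assoc _ _ _) ⟨
          atLevel δ S k τ ∙ S τ σ
            ≡⟨ ≡.cong (λ i → atLevel δ S i τ ∙ S τ σ) (ℕ.+-comm m n) ⟩
          atLevel δ S (n ℕ.+ m) τ ∙ S τ σ
            ≈⟨ ∼-∙-cong σ (∼-antitone-≤ σ≤τ (atLevel-+ τ<δ m n (level-bound δ τ<δ em))) (∼.refl σ) ⟩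
          atLevel δ S m τ ∙ S τ σ ∎
          where
          open SetoidReasoning (∼-setoid σ)
          σ<δ = ≤-<-trans σ≤τ τ<δ
          n = level δ σ em
          m = level δ τ em
          k = m ℕ.+ n
          τ≤sₖ : τ ≤ L.rung δ k
          τ≤sₖ = ≡.subst (λ i → τ ≤ L.rung δ i) (ℕ.+-comm n m)
            (≤-trans (level-bound δ τ<δ em) (rung-mono m n))

        correction-coherent : ∀ {σ τ} → σ ≤ τ → τ < δ → ∀ x d →
                              correction δ x d σ ∼[ σ ] correction δ x d τ
        correction-coherent σ≤τ           τ<δ x (yes _) = ∼.refl _
        correction-coherent (inj₁ σ<τ)    τ<δ x (no _)  = w-coherent δ σ<τ τ<δ
        correction-coherent (inj₂ ≡.refl) τ<δ x (no _)  = ∼.refl _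

        -- From σ on the correction is constant modulo level σ, so it multiplies both sides by the
        -- same class.
        corrected-coherent : ∀ {σ τ} → σ ≤ τ → τ < δ →
                             corrected δ S σ ∼[ σ ] (corrected δ S τ ∙ S τ σ)
        corrected-coherent {σ} σ≤τ τ<δ = ∼.trans σ
          (∼-∙-cong σ (extend-coherent σ≤τ τ<δ) (correction-coherent σ≤τ τ<δ (extend δ S) em))
          (∼-reflexive σ (xy∙z≈xz∙y _ _ _))

      corrected-P : ∀ δ S → P δ (corrected δ S)
      corrected-P δ S = go em
        where
        go : ∀ d → P δ (λ σ → extend δ S σ ∙ correction δ (extend δ S) d σ)
        go (yes Px) = P-resp δ (λ σ _ → sym (identityʳ _)) Px
        go (no ¬Px) = w-corrects δ (extend δ S) ¬Px

      extendByε : ∀ δ → (∀ τ → τ < δ → Ω → Carrier) → System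
      extendByε δ f τ σ with τ <? δ
      ... | yes τ<δ = f τ τ<δ σ
      ... | no  _   = ε

      recursor : ∀ δ → Acc _<_ δ → Ω → Carrier
      recursor δ (acc below) = step δ (extendByε δ λ τ τ<δ → recursor τ (below τ<δ))

      extendByε-cong : ∀ δ {f g : ∀ τ → τ < δ → Ω → Carrier} →
        (∀ τ (p : τ < δ) σ → f τ p σ ≈ g τ p σ) → ∀ τ σ → extendByε δ f τ σ ≈ extendByε δ g τ σ
      extendByε-cong δ f≈g τ σ with τ <? δ
      ... | yes τ<δ = f≈g τ τ<δ σ
      ... | no  _   = refl

      -- Without function extensionality the recursor depends on the accessibility
      -- proof only up to _≈_.
      recursor-irrelevant : ∀ δ (a a′ : Acc _<_ δ) σ → recursor δ a σ ≈ recursor δ a′ σ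
      recursor-irrelevant δ (acc below) (acc below′) = step-cong δ (extendByε-cong δ
        λ τ τ<δ → recursor-irrelevant τ (below τ<δ) (below′ τ<δ))

    e : Ω → Ω → Carrier
    e δ = recursor δ (Omega₁.wellFounded ω₁ δ)

    private
      history : Ω → System
      history δ = extendByε δ λ τ _ → e τ

      e-unfold : ∀ δ σ → e δ σ ≈ step δ (history δ) σ
      e-unfold δ = unfold (Omega₁.wellFounded ω₁ δ)
        where
        unfold : ∀ a σ → recursor δ a σ ≈ step δ (history δ) σ
        unfold (acc below) = step-cong δ (extendByε-cong δ
          λ τ τ<δ → recursor-irrelevant τ (below τ<δ) (Omega₁.wellFounded ω₁ τ))

      history-< : ∀ {δ τ} → τ < δ → ∀ σ → history δ τ σ ≈ e τ σ
      history-< {δ} {τ} τ<δ σ with τ <? δ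
      ... | yes _   = refl
      ... | no  τ≮δ = contradiction τ<δ τ≮δ

      e-< : ∀ {δ σ} → σ < δ → e δ σ ≈ corrected δ (history δ) σ
      e-< {δ} {σ} σ<δ = trans (e-unfold δ σ) step-<
        where
        step-< : step δ (history δ) σ ≈ corrected δ (history δ) σ
        step-< with σ <? δ
        ... | yes _   = refl
        ... | no  σ≮δ = contradiction σ<δ σ≮δ

    e-refl : ∀ δ → e δ δ ≈ ε
    e-refl δ = trans (e-unfold δ δ) step-refl
      where
      step-refl : step δ (history δ) δ ≈ ε
      step-refl with δ <? δ
      ... | yes δ<δ = contradiction δ<δ (<-irrefl ≡.refl)
      ... | no  _   = refl

    -- Row δ sees earlier rows only through `history`, which agrees with `e` below δ; the case τ = δ
    -- is `e-refl`.
    e-coherent : ∀ δ {σ τ} → σ ≤ τ → τ ≤ δ → e δ σ ∼[ σ ] (e δ τ ∙ e τ σ)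
    e-coherent = All.wfRec (Omega₁.wellFounded ω₁) ℓ (Coherent e) extendCoherence
      where
      extendCoherence : ∀ δ → (∀ {ρ} → ρ < δ → Coherent e ρ) → Coherent e δ
      extendCoherence δ below {σ} σ≤τ (inj₂ ≡.refl) =
        ∼-reflexive σ (sym (trans (∙-congʳ (e-refl δ)) (identityˡ _)))
      extendCoherence δ below {σ} {τ} σ≤τ (inj₁ τ<δ) = begin
        e δ σ                                     ≈⟨ ∼-reflexive σ (e-< (≤-<-trans σ≤τ τ<δ)) ⟩
        corrected δ (history δ) σ                 ≈⟨ corrected-coherent δ history-coherent σ≤τ τ<δ ⟩
        corrected δ (history δ) τ ∙ history δ τ σ
          ≈⟨ ∼-reflexive σ (∙-cong (sym (e-< τ<δ)) (history-< τ<δ σ)) ⟩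
        e δ τ ∙ e τ σ                             ∎
        where
        open SetoidReasoning (∼-setoid σ)
        history-coherent : ∀ {ρ} → ρ < δ → Coherent (history δ) ρ
        history-coherent ρ<δ {σ} σ≤τ τ≤ρ = ∼.trans σ (∼-reflexive σ (history-< ρ<δ _))
          (∼.trans σ (below ρ<δ σ≤τ τ≤ρ)
            (∼-reflexive σ (sym (∙-cong (history-< ρ<δ _) (history-< (≤-<-trans τ≤ρ ρ<δ) _)))))

    e-P : ∀ δ → P δ (e δ)
    e-P δ = P-resp δ (λ σ σ<δ → sym (e-< σ<δ)) (corrected-P δ (history δ))

-- Units, divisibility and congruences in a valuation domain

module _ {c ℓ} (M : CommutativeMonoid c ℓ) where
  open CommutativeMonoid M
  open AlgebraDefinitions _≈_ using (Invertible)
  open CommutativeSemigroupProperties commutativeSemigroup using (interchange)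

  unitGroup : AbelianGroup _ _
  unitGroup = record
    { Carrier = ∃ (Invertible ε _∙_)
    ; _≈_     = λ x y → proj₁ x ≈ proj₁ y
    ; _∙_     = λ (x , x⁻¹ , x⁻¹x≈ε , xx⁻¹≈ε) (y , y⁻¹ , y⁻¹y≈ε , yy⁻¹≈ε) →
        x ∙ y , x⁻¹ ∙ y⁻¹ , product x⁻¹x≈ε y⁻¹y≈ε , product xx⁻¹≈ε yy⁻¹≈ε
    ; ε       = ε , ε , identityˡ ε , identityˡ ε
    ; _⁻¹     = λ (x , x⁻¹ , x⁻¹x≈ε , xx⁻¹≈ε) → x⁻¹ , x , xx⁻¹≈ε , x⁻¹x≈ε
    ; isAbelianGroup = record
      { isGroup = record
        { isMonoid = record
          { isSemigroup = record
            { isMagma = record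
              { isEquivalence = On.isEquivalence proj₁ isEquivalence
              ; ∙-cong        = ∙-cong
              }
            ; assoc = λ _ _ _ → assoc _ _ _
            }
          ; identity = (λ _ → identityˡ _) , (λ _ → identityʳ _)
          }
        ; inverse = (λ (_ , _ , x⁻¹x≈ε , _) → x⁻¹x≈ε) , (λ (_ , _ , _ , xx⁻¹≈ε) → xx⁻¹≈ε)
        -- Equality ignores the stored inverse, so this rests on uniqueness of inverses.
        ; ⁻¹-cong = λ {x} {y} → inverse-cong x y
        }
      ; comm = λ _ _ → comm _ _
      }
    }
    where
    product : ∀ {x y x′ y′} → x ∙ y ≈ ε → x′ ∙ y′ ≈ ε → (x ∙ x′) ∙ (y ∙ y′) ≈ ε
    product xy≈ε x′y′≈ε = trans (interchange _ _ _ _) (trans (∙-cong xy≈ε x′y′≈ε) (identityˡ ε))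

    inverse-cong : ∀ (x y : ∃ (Invertible ε _∙_)) → proj₁ x ≈ proj₁ y →
                   proj₁ (proj₂ x) ≈ proj₁ (proj₂ y)
    inverse-cong (x , x⁻¹ , x⁻¹x≈ε , _) (y , y⁻¹ , _ , yy⁻¹≈ε) x≈y = begin
      x⁻¹             ≈⟨ identityʳ x⁻¹ ⟨
      x⁻¹ ∙ ε         ≈⟨ ∙-congˡ yy⁻¹≈ε ⟨
      x⁻¹ ∙ (y ∙ y⁻¹) ≈⟨ assoc _ _ _ ⟨
      (x⁻¹ ∙ y) ∙ y⁻¹ ≈⟨ ∙-congʳ (trans (∙-congˡ (sym x≈y)) x⁻¹x≈ε) ⟩
      ε ∙ y⁻¹         ≈⟨ identityˡ y⁻¹ ⟩
      y⁻¹             ∎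
      where open SetoidReasoning setoid

module _ {ℓ} (V : ValuationDomain ℓ) where
  open ValuationDomain V
  open RingProperties ring using (-‿distribˡ-*)
  open AbelianGroupProperties +-abelianGroup using (//-rightDividesʳ)
  open SetoidReasoning setoid

  ∣-difference : ∀ {x y z} → x ∣ y + z → x ∣ z → x ∣ y
  ∣-difference {x} {y} {z} (k Divisibility., kx≈y+z) (l Divisibility., lx≈z) =
    k - l Divisibility., (begin
      (k - l) * x       ≈⟨ distribʳ x k (- l) ⟩
      k * x + - l * x   ≈⟨ +-cong kx≈y+z (trans (sym (-‿distribˡ-* l x)) (-‿cong lx≈z)) ⟩
      (y + z) + - z     ≈⟨ //-rightDividesʳ z y ⟩
      y                 ∎)

  ∣-unit : ∀ {x y} → x ∣ y → Unit commutativeRing y → Unit commutativeRing x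
  ∣-unit {x} {y} (k Divisibility., kx≈y) (y⁻¹ , y⁻¹y≈1 , _) =
    y⁻¹ * k , y⁻¹kx≈1 , trans (*-comm x (y⁻¹ * k)) y⁻¹kx≈1
    where
    y⁻¹kx≈1 : y⁻¹ * k * x ≈ 1#
    y⁻¹kx≈1 = trans (*-assoc _ _ _) (trans (*-congˡ kx≈y) y⁻¹y≈1)

  -- A valuation domain is local. If `y` divides `x + y` it divides the unit `x`, which is excluded;
  -- hence `x + y` divides `y`, and therefore `x`.
  unit-+ : ∀ {x} y → Unit commutativeRing x → ¬ Unit commutativeRing y →
           Unit commutativeRing (x + y)
  unit-+ {x} y x-unit y-nonunit with ∣-total y (x + y)
  ... | inj₁ y∣x+y =
    contradiction (∣-unit (∣-difference y∣x+y (1# Divisibility., *-identityˡ y)) x-unit) y-nonunit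
  ... | inj₂ x+y∣y = ∣-unit (∣-difference (1# Divisibility., *-identityˡ (x + y)) x+y∣y) x-unit

module Fractions {ℓ} (V : ValuationDomain ℓ) (Q : QuotientField V) where
  private module R = ValuationDomain V
  open QuotientField Q
  open IsField isField using (invertible)
  open SetoidReasoning setoid

  ι≉0 : ∀ {s} → ¬ s R.≈ R.0# → ¬ ι s ≈ 0#
  ι≉0 s≉0 ιs≈0 = s≉0 (ι-injective (trans ιs≈0 (sym 0#-homo)))

  *-cancelˡ : ∀ {x y z} → ¬ x ≈ 0# → x * y ≈ x * z → y ≈ z
  *-cancelˡ {x} {y} {z} x≉0 xy≈xz = let x⁻¹ , x⁻¹x≈1 , _ = invertible x x≉0 in begin
    y               ≈⟨ *-identityˡ y ⟨
    1# * y          ≈⟨ *-congʳ x⁻¹x≈1 ⟨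
    x⁻¹ * x * y     ≈⟨ *-assoc _ _ _ ⟩
    x⁻¹ * (x * y)   ≈⟨ *-congˡ xy≈xz ⟩
    x⁻¹ * (x * z)   ≈⟨ *-assoc _ _ _ ⟨
    x⁻¹ * x * z     ≈⟨ *-congʳ x⁻¹x≈1 ⟩
    1# * z          ≈⟨ *-identityˡ z ⟩
    z               ∎

  -- Numerator and denominator of `q` are comparable under divisibility.
  integral-or-inverse : ∀ q → IsIntegral q ⊎ (∃[ s ] ι s * q ≈ 1#)
  integral-or-inverse q with fraction q
  ... | a , b , b≉0 , bq≈a with R.∣-total b a
  ...   | inj₁ (k Divisibility., kb≈a) = inj₁ (k , *-cancelˡ (ι≉0 b≉0) (begin
    ι b * ι k   ≈⟨ *-comm _ _ ⟩
    ι k * ι b   ≈⟨ *-homo k b ⟨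
    ι (k R.* b) ≈⟨ ι-cong kb≈a ⟩
    ι a         ≈⟨ bq≈a ⟨
    ι b * q     ∎))
  ...   | inj₂ (k Divisibility., ka≈b) = inj₂ (k , *-cancelˡ (ι≉0 b≉0) (begin
    ι b * (ι k * q) ≈⟨ CommutativeSemigroupProperties.x∙yz≈y∙xz *-commutativeSemigroup _ _ _ ⟩
    ι k * (ι b * q) ≈⟨ *-congˡ bq≈a ⟩
    ι k * ι a       ≈⟨ *-homo k a ⟨
    ι (k R.* a)     ≈⟨ ι-cong ka≈b ⟩
    ι b             ≈⟨ *-identityʳ (ι b) ⟨
    ι b * 1#        ∎))

module Congruence {ℓ} (ω₁ : Omega₁ ℓ) (V : ValuationDomain ℓ) (Q : QuotientField V)
  (A : Types.QSubmodule V Q) (r : Omega₁.Carrier ω₁ → ValuationDomain.Carrier V)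
  (r≉0 : ∀ σ → ¬ ValuationDomain._≈_ V (r σ) (ValuationDomain.0# V))
  (r-increasing : ∀ {σ τ} → Omega₁._<_ ω₁ σ τ → ValuationDomain._∣_ V (r σ) (r τ))
  where
  private
    module R = ValuationDomain V
    module A = Submodule A
  open Omega₁ ω₁ using (_<_) renaming (Carrier to Ω)
  open QuotientField Q
  open Types V Q
  open Gamma ω₁ V Q
  open Fractions V Q
  open IsField isField using (invertible)
  open RingSolver commutativeSemiring
  open AbelianGroupProperties +-abelianGroup using (//-rightDividesˡ; //-rightDividesʳ)
  open SetoidReasoning setoid

  infix 4 _≡_[mod_]
  _≡_[mod_] : Carrier → Carrier → Ω → Set ℓ
  p ≡ q [mod σ ] = ∃[ a ] (A.Member a × p ≈ q + ι (r σ) * a)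

  module _ {σ : Ω} where
    ≡-reflexive : ∀ {p q} → p ≈ q → p ≡ q [mod σ ]
    ≡-reflexive {p} {q} p≈q = 0# , A.0-closed , (begin
      p                     ≈⟨ p≈q ⟩
      q                     ≈⟨ +-identityʳ q ⟨
      q + 0#                ≈⟨ +-congˡ (zeroʳ _) ⟨
      q + ι (r σ) * 0#      ∎)

    ≡-sym : ∀ {p q} → p ≡ q [mod σ ] → q ≡ p [mod σ ]
    ≡-sym {p} {q} (a , Aa , p≈q+ra) = - a , neg-closed asModule A Aa , (begin
      q                                         ≈⟨ //-rightDividesʳ (ι (r σ) * a) q ⟨
      (q + ι (r σ) * a) - ι (r σ) * a
        ≈⟨ +-cong (sym p≈q+ra) (RingProperties.-‿distribʳ-* ring _ _) ⟩
      p + ι (r σ) * - a                         ∎)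

    ≡-trans : ∀ {p q s} → p ≡ q [mod σ ] → q ≡ s [mod σ ] → p ≡ s [mod σ ]
    ≡-trans {p} {q} {s} (a , Aa , p≈q+ra) (b , Ab , q≈s+rb) = b + a , A.+-closed Ab Aa , (begin
      p                                 ≈⟨ p≈q+ra ⟩
      q + ι (r σ) * a                   ≈⟨ +-congʳ q≈s+rb ⟩
      s + ι (r σ) * b + ι (r σ) * a
        ≈⟨ solve 4 (λ s r b a → s :+ r :* b :+ r :* a := s :+ r :* (b :+ a)) refl s (ι (r σ)) b a ⟩
      s + ι (r σ) * (b + a)             ∎)

    ≡-isEquivalence : IsEquivalence (λ p q → p ≡ q [mod σ ])
    ≡-isEquivalence = record { refl = ≡-reflexive refl ; sym = ≡-sym ; trans = ≡-trans }

  ≡-setoid : Ω → Setoid ℓ ℓ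
  ≡-setoid σ = record { isEquivalence = ≡-isEquivalence {σ} }

  module _ {σ : Ω} where

    ≡-*ₗ : ∀ s {p q} → p ≡ q [mod σ ] → ι s * p ≡ ι s * q [mod σ ]
    ≡-*ₗ s {p} {q} (a , Aa , p≈q+ra) = ι s * a , A.*ₗ-closed s Aa , (begin
      ι s * p                         ≈⟨ *-congˡ p≈q+ra ⟩
      ι s * (q + ι (r σ) * a)
        ≈⟨ solve 4 (λ s q r a → s :* (q :+ r :* a) := s :* q :+ r :* (s :* a)) 
           refl (ι s) q (ι (r σ)) a ⟩
      ι s * q + ι (r σ) * (ι s * a)   ∎)

    ≡-*ᵣ : ∀ s {p q} → p ≡ q [mod σ ] → p * ι s ≡ q * ι s [mod σ ]
    ≡-*ᵣ s p≡q = ≡-trans (≡-reflexive (*-comm _ _))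
      (≡-trans (≡-*ₗ s p≡q) (≡-reflexive (*-comm _ _)))

    ≡-ι-*-cong : ∀ {x y u v} → ι x ≡ ι y [mod σ ] → ι u ≡ ι v [mod σ ] →
                 ι (x R.* u) ≡ ι (y R.* v) [mod σ ]
    ≡-ι-*-cong {x} {y} {u} {v} x≡y u≡v =
      ≡-trans (≡-reflexive (*-homo x u)) (≡-trans (≡-*ᵣ u x≡y)
        (≡-trans (≡-*ₗ y u≡v) (≡-reflexive (sym (*-homo y v)))))

    Scaled⇒≡ : ∀ {x y} → Scaled A r σ (ι (x R.- y)) → ι x ≡ ι y [mod σ ]
    Scaled⇒≡ {x} {y} (a , Aa , x-y≈ra) = a , Aa , (begin
      ι x                      ≈⟨ //-rightDividesˡ (ι y) (ι x) ⟨
      (ι x - ι y) + ι y        ≈⟨ +-congʳ (+-congˡ (sym (-‿homo y))) ⟩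
      (ι x + ι (R.- y)) + ι y  ≈⟨ +-congʳ (sym (+-homo x (R.- y))) ⟩
      ι (x R.- y) + ι y        ≈⟨ +-comm _ _ ⟩
      ι y + ι (x R.- y)        ≈⟨ +-congˡ x-y≈ra ⟩
      ι y + ι (r σ) * a        ∎)

  ≡-antitone : ∀ {σ τ} → σ < τ → ∀ {p q} → p ≡ q [mod τ ] → p ≡ q [mod σ ]
  ≡-antitone {σ} {τ} σ<τ {p} {q} (a , Aa , p≈q+ra) with r-increasing σ<τ
  ... | k Divisibility., kr≈r = ι k * a , A.*ₗ-closed k Aa , (begin
    p                               ≈⟨ p≈q+ra ⟩
    q + ι (r τ) * a                 ≈⟨ +-congˡ (*-congʳ (ι-cong kr≈r)) ⟨
    q + ι (k R.* r σ) * a           ≈⟨ +-congˡ (*-congʳ (*-homo k (r σ))) ⟩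
    q + ι k * ι (r σ) * a
      ≈⟨ solve 4 (λ q k r a → q :+ k :* r :* a := q :+ r :* (k :* a)) refl q (ι k) (ι (r σ)) a ⟩
    q + ι (r σ) * (ι k * a)         ∎)

  abstract
    r⁻¹ : Ω → Carrier
    r⁻¹ σ = proj₁ (invertible (ι (r σ)) (ι≉0 (r≉0 σ)))

    r*r⁻¹ : ∀ σ → ι (r σ) * r⁻¹ σ ≈ 1#
    r*r⁻¹ σ = proj₂ (proj₂ (invertible (ι (r σ)) (ι≉0 (r≉0 σ))))

  -- The equation says that `r⁻¹ σ` is the multiple of `a` by `s`.
  r⁻¹∈A : ∀ σ s {a} → A.Member a → ι s * (ι (r σ) * a) ≈ 1# → A.Member (r⁻¹ σ)
  r⁻¹∈A σ s {a} Aa sra≈1 = A.resp (begin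
    ι s * a                           ≈⟨ *-identityʳ _ ⟨
    ι s * a * 1#                      ≈⟨ *-congˡ (r*r⁻¹ σ) ⟨
    ι s * a * (ι (r σ) * r⁻¹ σ)
      ≈⟨ solve 4 (λ s a r r′ → s :* a :* (r :* r′) := s :* (r :* a) :* r′) 
         refl (ι s) a (ι (r σ)) (r⁻¹ σ) ⟩
    ι s * (ι (r σ) * a) * r⁻¹ σ       ≈⟨ *-congʳ sra≈1 ⟩
    1# * r⁻¹ σ                        ≈⟨ *-identityˡ _ ⟩
    r⁻¹ σ                             ∎) (A.*ₗ-closed s Aa)

  -- r σ A is contained in the maximal ideal of R as soon as r⁻¹ σ ∉ A.
  unit-mod : ∀ {σ} → ¬ A.Member (r⁻¹ σ) → ∀ {u p} → Unit R.commutativeRing u →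
             p ≡ ι u [mod σ ] → ∃[ v ] (Unit R.commutativeRing v × ι v ≈ p)
  unit-mod {σ} r⁻¹∉A {u} {p} u-unit (a , Aa , p≈u+ra) with integral-or-inverse (ι (r σ) * a)
  ... | inj₂ (s , sra≈1) = contradiction (r⁻¹∈A σ s Aa sra≈1) r⁻¹∉A
  ... | inj₁ (s , s≈ra)  = u R.+ s , unit-+ V s u-unit s-nonunit ,
          trans (+-homo u s) (trans (+-congˡ s≈ra) (sym p≈u+ra))
    where
    s-nonunit : ¬ Unit R.commutativeRing s
    s-nonunit (s⁻¹ , s⁻¹s≈1 , _) = r⁻¹∉A (r⁻¹∈A σ s⁻¹ Aa (begin
      ι s⁻¹ * (ι (r σ) * a) ≈⟨ *-congˡ s≈ra ⟨
      ι s⁻¹ * ι s           ≈⟨ *-homo s⁻¹ s ⟨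
      ι (s⁻¹ R.* s)         ≈⟨ trans (ι-cong s⁻¹s≈1) 1#-homo ⟩
      1#                    ∎))

-- Coherent units whose rows escape at every point of `E′`

module TwistingUnits (em : ∀ {a} → ExcludedMiddle a) {ℓ} (ω₁ : Omega₁ ℓ)
  (V : ValuationDomain ℓ) (Q : QuotientField V) (A : Types.QSubmodule V Q)
  (r : Omega₁.Carrier ω₁ → ValuationDomain.Carrier V)
  (r≉0 : ∀ σ → ¬ ValuationDomain._≈_ V (r σ) (ValuationDomain.0# V))
  (r-increasing : ∀ {σ τ} → Omega₁._<_ ω₁ σ τ → ValuationDomain._∣_ V (r σ) (r τ))
  (N : Omega₁.Carrier ω₁ → Pred (ValuationDomain.Carrier V) ℓ)
  (N-filtration : Gamma.IsFiltration ω₁ V Q r N)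
  where
  private
    module R = ValuationDomain V
    module A = Submodule A
    module N δ = IsSubring (Gamma.IsFiltration.subring N-filtration δ)
  open Omega₁ ω₁ using (_<_) renaming (Carrier to Ω)
  open Ordinals em ω₁ using (_<?_; <-trans)
  open QuotientField Q
  open Types V Q
  open Gamma ω₁ V Q
  open Fractions V Q
  open Congruence ω₁ V Q A r r≉0 r-increasing
  open RingSolver R.commutativeSemiring

  G : AbelianGroup ℓ ℓ
  G = unitGroup R.*-commutativeMonoid
  module G = AbelianGroup G

  infix 4 _∈N_+r_A
  _∈N_+r_A : R.Carrier → Ω → Ω → Set ℓ
  x ∈N δ +r σ A = ∃[ n ] (N δ n × ι x ≡ ι n [mod σ ])

  Capturable : Ω → Pred (Ω → G.Carrier) ℓ
  Capturable δ x = ∃[ f ] (Unit R.commutativeRing f × ∀ σ → σ < δ → (proj₁ (x σ) R.* f) ∈N δ +r σ A)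

  -- The premise makes the condition vacuous off `E′`, where no sequence for a correction is given.
  Escapes : Ω → Pred (Ω → G.Carrier) ℓ
  Escapes δ x = E′ A r N δ → ¬ Capturable δ x

  Escapes-resp : ∀ δ {x y} → (∀ σ → σ < δ → x σ G.≈ y σ) → Escapes δ x → Escapes δ y
  Escapes-resp δ x≈y escapes δ∈E′ (f , f-unit , captured) = escapes δ∈E′ (f , f-unit , λ σ σ<δ →
    let n , Nn , yf≡n = captured σ σ<δ
    in n , Nn , ≡-trans (≡-reflexive (ι-cong (R.*-congʳ (x≈y σ σ<δ)))) yf≡n)

  ∈N⇒+Scaled : ∀ {x δ σ} → x ∈N δ +r σ A → _+Scaled_ A r N δ σ (ι x)
  ∈N⇒+Scaled (n , Nn , a , Aa , x≈n+ra) = n , _ , Nn , (a , Aa , refl) , x≈n+ra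

  -- In this case `r σ A` contains R, so 0 already represents `x`.
  r⁻¹∈A⇒∈N : ∀ {δ σ} → A.Member (r⁻¹ σ) → ∀ x → x ∈N δ +r σ A
  r⁻¹∈A⇒∈N {δ} {σ} Ar⁻¹ x = R.0# , N.0-closed δ , ι x * r⁻¹ σ , A.*ₗ-closed x Ar⁻¹ , (begin
    ι x                                 ≈⟨ *-identityʳ _ ⟨
    ι x * 1#                            ≈⟨ *-congˡ (r*r⁻¹ σ) ⟨
    ι x * (ι (r σ) * r⁻¹ σ)             ≈⟨ x∙yz≈y∙xz _ _ _ ⟩
    ι (r σ) * (ι x * r⁻¹ σ)             ≈⟨ +-identityˡ _ ⟨
    0# + ι (r σ) * (ι x * r⁻¹ σ)        ≈⟨ +-congʳ 0#-homo ⟨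
    ι R.0# + ι (r σ) * (ι x * r⁻¹ σ)    ∎)
    where
    open SetoidReasoning setoid
    open CommutativeSemigroupProperties *-commutativeSemigroup using (x∙yz≈y∙xz)

  -- The element is the quotient of `x u f′` by `x f`. When `r σ A` lies in the maximal ideal, the
  -- representative `n` of the unit `x f` is a unit too, and the condition on units in the
  -- filtration gives an inverse `m` of `n` inside `N δ`.
  ∈N-quotient : ∀ {δ σ x f f⁻¹ u f′} → Unit R.commutativeRing x → f R.* f⁻¹ R.≈ R.1# →
    f⁻¹ R.* f R.≈ R.1# → (x R.* f) ∈N δ +r σ A → (x R.* u R.* f′) ∈N δ +r σ A →
    (u R.* (f′ R.* f⁻¹)) ∈N δ +r σ A
  ∈N-quotient {δ} {σ} {x} {f} {f⁻¹} {u} {f′} x-unit ff⁻¹≈1 f⁻¹f≈1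
    (n , Nn , xf≡n) (n′ , Nn′ , xuf′≡n′)
    with em {P = A.Member (r⁻¹ σ)}
  ... | yes Ar⁻¹ = r⁻¹∈A⇒∈N Ar⁻¹ _
  ... | no r⁻¹∉A =
    let v , v-unit , v≈n = unit-mod r⁻¹∉A
          (proj₂ ((x , x-unit) G.∙ (f , f⁻¹ , f⁻¹f≈1 , ff⁻¹≈1))) (≡-sym xf≡n)
        v∣n = R.1# Divisibility., R.trans (R.*-identityˡ n) (ι-injective (sym v≈n))
        _ , m , Nm , nm≈1 = proj₁ (units δ) (∣-unit V v∣n v-unit , Nn)
    in n′ R.* m , N.*-closed δ Nn′ Nm , divide nm≈1
    where
    open Gamma.IsFiltration N-filtration using (units)
    open SetoidReasoning (On.setoid (≡-setoid σ) ι)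
    divide : ∀ {m} → n R.* m R.≈ R.1# → ι (u R.* (f′ R.* f⁻¹)) ≡ ι (n′ R.* m) [mod σ ]
    divide {m} nm≈1 = begin
      u R.* (f′ R.* f⁻¹)
        ≈⟨ ≡-ι (R.sym (R.trans (R.*-congˡ nm≈1) (R.*-identityʳ _))) ⟩
      u R.* (f′ R.* f⁻¹) R.* (n R.* m)
        ≈⟨ ≡-ι-*-cong (≡-ι R.refl) (≡-ι-*-cong xf≡n (≡-ι R.refl)) ⟨
      u R.* (f′ R.* f⁻¹) R.* (x R.* f R.* m)
        ≈⟨ ≡-ι (solve 6 (λ u f′ f⁻¹ x f m →
                  u :* (f′ :* f⁻¹) :* (x :* f :* m) := x :* u :* f′ :* m :* (f :* f⁻¹))
                R.refl u f′ f⁻¹ x f m) ⟩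
      x R.* u R.* f′ R.* m R.* (f R.* f⁻¹)  ≈⟨ ≡-ι (R.trans (R.*-congˡ ff⁻¹≈1) (R.*-identityʳ _)) ⟩
      x R.* u R.* f′ R.* m                  ≈⟨ ≡-ι-*-cong xuf′≡n′ (≡-ι R.refl) ⟩
      n′ R.* m                              ∎
      where
      ≡-ι : ∀ {x y} → x R.≈ y → ι x ≡ ι y [mod σ ]
      ≡-ι x≈y = ≡-reflexive (ι-cong x≈y)

  private
    twist : ∀ δ → Dec (E′ A r N δ) → Ω → G.Carrier
    twist δ (no  _)                           σ = G.ε
    twist δ (yes (_ , u , (u-units , _) , _)) σ with σ <? δ
    ... | yes σ<δ = u σ , u-units σ σ<δ
    ... | no  _   = G.ε

    twist-coherent : ∀ δ d {σ τ} → σ < τ → τ < δ →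
                     ι (proj₁ (twist δ d σ)) ≡ ι (proj₁ (twist δ d τ)) [mod σ ]
    twist-coherent δ (no _) σ<τ τ<δ = ≡-reflexive refl
    twist-coherent δ (yes (_ , u , (_ , u-coherent) , _)) {σ} {τ} σ<τ τ<δ with σ <? δ | τ <? δ
    ... | yes _   | yes _   = ≡-sym (Scaled⇒≡ (u-coherent σ τ σ<τ τ<δ))
    ... | no  σ≮δ | _       = contradiction (<-trans σ<τ τ<δ) σ≮δ
    ... | yes _   | no  τ≮δ = contradiction τ<δ τ≮δ

    twist-≈ : ∀ δ δ∈E′ {σ} → σ < δ → proj₁ (twist δ (yes δ∈E′) σ) R.≈ proj₁ (proj₂ δ∈E′) σ
    twist-≈ δ δ∈E′ {σ} σ<δ with σ <? δ
    ... | yes _   = R.refl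
    ... | no  σ≮δ = contradiction σ<δ σ≮δ

    -- If f captures x and f′ captures x u, then f′ f⁻¹ captures u.
    twist-corrects : ∀ δ d x → ¬ Escapes δ x → Escapes δ (λ σ → x σ G.∙ twist δ d σ)
    twist-corrects δ (no δ∉E′) x _ δ∈E′ = contradiction δ∈E′ δ∉E′
    twist-corrects δ (yes δ∈E′@(_ , u , _ , u-escapes)) x ¬escapes _ (f′ , f′-unit , xu-captured) =
      ¬escapes λ _ (f , f-unit@(f⁻¹ , f⁻¹f≈1 , ff⁻¹≈1) , x-captured) →
        let σ , σ<δ , uf″∉ = u-escapes (f′ R.* f⁻¹) (proj₂ ((f′ , f′-unit) G.∙ (f , f-unit) G.⁻¹))
            n′ , Nn′ , xuf′≡n′ = xu-captured σ σ<δ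
            xuf′≈ = R.*-congʳ (R.*-congˡ (R.sym (twist-≈ δ δ∈E′ σ<δ)))
        in uf″∉ (∈N⇒+Scaled (∈N-quotient (proj₂ (x σ)) ff⁻¹≈1 f⁻¹f≈1 (x-captured σ σ<δ)
             (n′ , Nn′ , ≡-trans (≡-reflexive (ι-cong xuf′≈)) xuf′≡n′)))

  open CoherentSystem.Rows em ω₁ G
    (λ x σ y → ι (proj₁ x) ≡ ι (proj₁ y) [mod σ ])
    (λ σ → On.isEquivalence (λ x → ι (proj₁ x)) ≡-isEquivalence)
    (λ σ → ≡-ι-*-cong)
    (λ σ x≈y → ≡-reflexive (ι-cong x≈y))
    (λ σ<τ → ≡-antitone σ<τ)
    Escapes Escapes-resp
    (λ δ → twist δ em) (λ δ → twist-coherent δ em) (λ δ → twist-corrects δ em)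
    public using (e; e-refl; e-coherent) renaming (e-P to e-escapes)

-- The glued module

module _ {ℓ} {R : CommutativeRing ℓ ℓ} (M : Module R ℓ ℓ) where
  open Module M
  open CommutativeRing R using (_≈_; _+_; _*_; 0#; 1#)
  private module G = AbelianGroupProperties +ᴹ-abelianGroup

  Power : Set ℓ → Module R ℓ ℓ
  Power I = record
    { Carrierᴹ = I → Carrierᴹ
    ; _≈ᴹ_     = λ f g → ∀ i → f i ≈ᴹ g i
    ; _+ᴹ_     = λ f g i → f i +ᴹ g i
    ; _*ₗ_     = λ s f i → s *ₗ f i
    ; _*ᵣ_     = λ f s i → s *ₗ f i
    ; 0ᴹ       = λ _ → 0ᴹ
    ; -ᴹ_      = λ f i → -ᴹ f i
    ; isModule = IsModuleFromLeft.isModule {commutativeRing = R} (record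
      { isLeftModule = record
        { isLeftSemimodule = record
          { +ᴹ-isCommutativeMonoid = record
            { isMonoid = record
              { isSemigroup = record
                { isMagma = record
                  { isEquivalence = record
                    { refl  = λ _ → ≈ᴹ-refl
                    ; sym   = λ f≈g i → ≈ᴹ-sym (f≈g i)
                    ; trans = λ f≈g g≈h i → ≈ᴹ-trans (f≈g i) (g≈h i)
                    }
                  ; ∙-cong = λ f≈g f′≈g′ i → +ᴹ-cong (f≈g i) (f′≈g′ i)
                  }
                ; assoc = λ _ _ _ _ → +ᴹ-assoc _ _ _
                }
              ; identity = (λ _ _ → +ᴹ-identityˡ _) , (λ _ _ → +ᴹ-identityʳ _)
              }
            ; comm = λ _ _ _ → +ᴹ-comm _ _
            }
          ; isPreleftSemimodule = record
            { *ₗ-cong      = λ r≈s f≈g i → *ₗ-cong r≈s (f≈g i)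
            ; *ₗ-zeroˡ     = λ _ _ → *ₗ-zeroˡ _
            ; *ₗ-distribʳ  = λ _ _ _ _ → *ₗ-distribʳ _ _ _
            ; *ₗ-identityˡ = λ _ _ → *ₗ-identityˡ _
            ; *ₗ-assoc     = λ _ _ _ _ → *ₗ-assoc _ _ _
            ; *ₗ-zeroʳ     = λ _ _ → *ₗ-zeroʳ _
            ; *ₗ-distribˡ  = λ _ _ _ _ → *ₗ-distribˡ _ _ _
            }
          }
        ; -ᴹ‿cong    = λ f≈g i → -ᴹ‿cong (f≈g i)
        ; -ᴹ‿inverse = (λ _ _ → -ᴹ‿inverseˡ _) , (λ _ _ → -ᴹ‿inverseʳ _)
        }
      })
    }

  whole : Submodule M
  whole = record
    { Member = λ _ → ⊤ ; resp = λ _ _ → tt ; 0-closed = tt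
    ; +-closed = λ _ _ → tt ; *ₗ-closed = λ _ _ → tt }

  module Modulo (N : Submodule M) where
    private
      module N = Submodule N
      module M/N = Module (Subquotient M whole N)

    -- A record, so that x and y can be inferred from x ≃ y.
    infix 4 _≃_
    record _≃_ (x y : Carrierᴹ) : Set ℓ where
      constructor ⟨_⟩
      field difference : N.Member (x +ᴹ (-ᴹ y))
    open _≃_ public

    ≃-isEquivalence : IsEquivalence _≃_
    ≃-isEquivalence = record
      { refl  = λ {x} → ⟨ M/N.≈ᴹ-refl {x , tt} ⟩
      ; sym   = λ {x} {y} x≃y → ⟨ M/N.≈ᴹ-sym {x , tt} {y , tt} (difference x≃y) ⟩
      ; trans = λ {x} {y} {z} x≃y y≃z →
          ⟨ M/N.≈ᴹ-trans {x , tt} {y , tt} {z , tt} (difference x≃y) (difference y≃z) ⟩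
      }

    ≃-setoid : Setoid ℓ ℓ
    ≃-setoid = record { isEquivalence = ≃-isEquivalence }

    open IsEquivalence ≃-isEquivalence public using ()
      renaming (sym to ≃-sym; trans to ≃-trans)

    ≃-+-cong : ∀ {x x′ y y′} → x ≃ x′ → y ≃ y′ → x +ᴹ y ≃ x′ +ᴹ y′
    ≃-+-cong {x} {x′} {y} {y′} x≃x′ y≃y′ =
      ⟨ M/N.+ᴹ-cong {x , tt} {x′ , tt} {y , tt} {y′ , tt} (difference x≃x′) (difference y≃y′) ⟩

    ≃-*ₗ : ∀ r {x y} → x ≃ y → r *ₗ x ≃ r *ₗ y
    ≃-*ₗ r {x} {y} x≃y = ⟨ M/N.*ₗ-congˡ {r} {x , tt} {y , tt} (difference x≃y) ⟩

    ≈⇒≃ : ∀ {x y} → x ≈ᴹ y → x ≃ y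
    ≈⇒≃ x≈y = ⟨ N.resp (≈ᴹ-sym (G.x≈y⇒x∙y⁻¹≈ε x≈y)) N.0-closed ⟩

    ≃-*ₗ-cong : ∀ {r s} → r ≈ s → ∀ x → r *ₗ x ≃ s *ₗ x
    ≃-*ₗ-cong r≈s x = ≈⇒≃ (*ₗ-congʳ r≈s)

    ≃-*ₗ-assoc : ∀ r s x → r *ₗ (s *ₗ x) ≃ (r * s) *ₗ x
    ≃-*ₗ-assoc r s x = ≈⇒≃ (≈ᴹ-sym (*ₗ-assoc r s x))

    ≃-*ₗ-distribʳ : ∀ r s x → r *ₗ x +ᴹ s *ₗ x ≃ (r + s) *ₗ x
    ≃-*ₗ-distribʳ r s x = ≈⇒≃ (≈ᴹ-sym (*ₗ-distribʳ x r s))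

    ≃-*ₗ-identityˡ : ∀ x → x ≃ 1# *ₗ x
    ≃-*ₗ-identityˡ x = ≈⇒≃ (≈ᴹ-sym (*ₗ-identityˡ x))

    ≃-*ₗ-zeroˡ : ∀ x → 0ᴹ ≃ 0# *ₗ x
    ≃-*ₗ-zeroˡ x = ≈⇒≃ (≈ᴹ-sym (*ₗ-zeroˡ x))

    private
      x-0≈x : ∀ x → x +ᴹ (-ᴹ 0ᴹ) ≈ᴹ x
      x-0≈x x = ≈ᴹ-trans (+ᴹ-congˡ G.ε⁻¹≈ε) (+ᴹ-identityʳ x)

    ∈⇒≃0 : ∀ {x} → N.Member x → x ≃ 0ᴹ
    ∈⇒≃0 Nx = ⟨ N.resp (≈ᴹ-sym (x-0≈x _)) Nx ⟩

    ≃0⇒∈ : ∀ {x} → x ≃ 0ᴹ → N.Member x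
    ≃0⇒∈ x≃0 = N.resp (x-0≈x _) (difference x≃0)

module GermModule (em : ∀ {a} → ExcludedMiddle a) {ℓ} (ω₁ : Omega₁ ℓ)
  (V : ValuationDomain ℓ) (Q : QuotientField V) (A : Types.QSubmodule V Q)
  (r : Omega₁.Carrier ω₁ → ValuationDomain.Carrier V)
  (r≉0 : ∀ σ → ¬ ValuationDomain._≈_ V (r σ) (ValuationDomain.0# V))
  (r-increasing : ∀ {σ τ} → Omega₁._<_ ω₁ σ τ → ValuationDomain._∣_ V (r σ) (r τ))
  where
  private
    module R = ValuationDomain V
    module A = Submodule A
    module G = AbelianGroup (unitGroup R.*-commutativeMonoid)
  open Omega₁ ω₁ using (_<_) renaming (Carrier to Ω)
  open Ordinals em ω₁
  open QuotientField Q
  open Types V Q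
  open Fractions V Q
  open Congruence ω₁ V Q A r r≉0 r-increasing
  open RingSolver commutativeSemiring
  open CommutativeSemigroupProperties *-commutativeSemigroup using (x∙yz≈y∙xz)
  open RingProperties ring using (x[y-z]≈xy-xz; [y-z]x≈yx-zx)
  open AbelianGroupProperties +-abelianGroup using (xyx⁻¹≈y; //-rightDividesˡ)
  open Modulo asModule A using () renaming
    ( _≃_ to _≃A_; ⟨_⟩ to ⟨_⟩A; difference to differenceA; ≃-setoid to ≃A-setoid
    ; ≃-trans to ≃A-trans; ≃-*ₗ to ≃A-*ₗ; ≈⇒≃ to ≈⇒≃A; ≃0⇒∈ to ≃0⇒∈A )

  ≃A⇒≡ : ∀ σ {p q} → p ≃A q → ι (r σ) * p ≡ ι (r σ) * q [mod σ ]
  ≃A⇒≡ σ {p} {q} p≃q = p - q , differenceA p≃q ,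
    trans (*-congˡ (trans (sym (//-rightDividesˡ q p)) (+-comm _ _))) (distribˡ _ _ _)

  ≡⇒≃A : ∀ {σ p q} → p ≡ q [mod σ ] → p * r⁻¹ σ ≃A q * r⁻¹ σ
  ≡⇒≃A {σ} {p} {q} (a , Aa , p≈q+ra) = ⟨ A.resp (begin
    a                                                     ≈⟨ xyx⁻¹≈y (q * r⁻¹ σ) a ⟨
    q * r⁻¹ σ + a - q * r⁻¹ σ
      ≈⟨ +-congʳ (+-congˡ (trans (*-congʳ (r*r⁻¹ σ)) (*-identityˡ a))) ⟨
    q * r⁻¹ σ + ι (r σ) * r⁻¹ σ * a - q * r⁻¹ σ
      ≈⟨ +-congʳ (solve 4 (λ q r′ r a → q :* r′ :+ r :* r′ :* a := (q :+ r :* a) :* r′) 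
                  refl q (r⁻¹ σ) (ι (r σ)) a) ⟩
    (q + ι (r σ) * a) * r⁻¹ σ - q * r⁻¹ σ                 ≈⟨ +-congʳ (*-congʳ p≈q+ra) ⟨
    p * r⁻¹ σ - q * r⁻¹ σ                                 ∎) Aa ⟩A
    where open SetoidReasoning setoid

  divisor : ∀ {σ τ} → σ ≤ τ → ∃[ t ] t R.* r σ R.≈ r τ
  divisor (inj₁ σ<τ) with r-increasing σ<τ
  ... | t Divisibility., tr≈r = t , tr≈r
  divisor (inj₂ ≡.refl) = R.1# , R.*-identityˡ _

  r⁻¹-shift : ∀ {σ τ t} → t R.* r σ R.≈ r τ → ι t * r⁻¹ τ ≈ r⁻¹ σ
  r⁻¹-shift {σ} {τ} {t} tr≈r = *-cancelˡ (ι≉0 (r≉0 σ)) (begin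
    ι (r σ) * (ι t * r⁻¹ τ)   ≈⟨ solve 3 (λ r t r′ → r :* (t :* r′) := t :* r :* r′) refl _ _ _ ⟩
    ι t * ι (r σ) * r⁻¹ τ     ≈⟨ *-congʳ (trans (sym (*-homo t (r σ))) (ι-cong tr≈r)) ⟩
    ι (r τ) * r⁻¹ τ           ≈⟨ r*r⁻¹ τ ⟩
    1#                        ≈⟨ r*r⁻¹ σ ⟨
    ι (r σ) * r⁻¹ σ           ∎)
    where open SetoidReasoning setoid

  Germs : Module R.commutativeRing ℓ ℓ
  Germs = Power asModule Ω

  open Module Germs using (_*ₗ_; 0ᴹ) renaming (Carrierᴹ to Germ)

  module Glued
    (e : Ω → Ω → G.Carrier)
    (e-coherent : ∀ δ {σ τ} → σ ≤ τ → τ ≤ δ →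
      ι (proj₁ (e δ σ)) ≡ ι (proj₁ (e δ τ) R.* proj₁ (e τ σ)) [mod σ ])
    (ν : Ω) (r⁻¹ν∉A : ¬ A.Member (r⁻¹ ν))
    where

    EventuallyA : Submodule Germs
    EventuallyA = record
      { Member    = λ f → ∃[ β ] (∀ ρ → β < ρ → A.Member (f ρ))
      ; resp      = λ f≈g (β , Af) → β , λ ρ β<ρ → A.resp (f≈g ρ) (Af ρ β<ρ)
      ; 0-closed  = ν , λ _ _ → A.0-closed
      ; +-closed  = λ (β , Af) (γ , Ag) → β ⊔ γ , λ ρ β⊔γ<ρ →
          A.+-closed (Af ρ (≤-<-trans (x≤x⊔y β γ) β⊔γ<ρ)) (Ag ρ (≤-<-trans (x≤y⊔x β γ) β⊔γ<ρ))
      ; *ₗ-closed = λ s (β , Af) → β , λ ρ β<ρ → A.*ₗ-closed s (Af ρ β<ρ)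
      }

    open Modulo Germs EventuallyA

    -- The class of `r⁻¹ σ` in stage σ, viewed from all stages ρ at once: the transition map from σ
    -- to ρ is multiplication by `e ρ σ`. Values at small ρ vanish modulo `EventuallyA`.
    generator : Ω → Germ
    generator σ ρ = ι (proj₁ (e ρ σ)) * r⁻¹ σ

    -- For every ρ above τ this is coherence modulo `r σ A` divided by `r σ`, because `t` times
    -- `r⁻¹ τ` is `r⁻¹ σ`.
    generator-shift : ∀ {σ τ t} → σ ≤ τ → t R.* r σ R.≈ r τ →
                      generator σ ≃ (proj₁ (e τ σ) R.* t) *ₗ generator τ
    generator-shift {σ} {τ} {t} σ≤τ tr≈r = ⟨ (τ , λ ρ τ<ρ →
      differenceA (let open SetoidReasoning ≃A-setoid in begin
      ι (proj₁ (e ρ σ)) * r⁻¹ σ                           ≈⟨ ≡⇒≃A (e-coherent ρ σ≤τ (inj₁ τ<ρ)) ⟩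
      ι (proj₁ (e ρ τ) R.* proj₁ (e τ σ)) * r⁻¹ σ
        ≈⟨ ≈⇒≃A (*-cong (*-homo _ _) (sym (r⁻¹-shift tr≈r))) ⟩
      ι (proj₁ (e ρ τ)) * ι (proj₁ (e τ σ)) * (ι t * r⁻¹ τ)
        ≈⟨ ≈⇒≃A (solve 4 (λ x y t r → x :* y :* (t :* r) := y :* t :* (x :* r)) refl _ _ _ _) ⟩
      ι (proj₁ (e τ σ)) * ι t * (ι (proj₁ (e ρ τ)) * r⁻¹ τ) ≈⟨ ≈⇒≃A (*-congʳ (sym (*-homo _ t))) ⟩
      ι (proj₁ (e τ σ) R.* t) * (ι (proj₁ (e ρ τ)) * r⁻¹ τ) ∎)) ⟩

    -- Evaluation at a single ρ beyond the bound suffices, since the unit `e ρ τ` cancels there.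
    generator-cancel : ∀ {τ s s′} → s *ₗ generator τ ≃ s′ *ₗ generator τ →
                       ι s * r⁻¹ τ ≃A ι s′ * r⁻¹ τ
    generator-cancel {τ} {s} {s′} ⟨ β , eventually ⟩ =
      let ρ , β<ρ = unbounded β
          eρτ , e⁻¹ , e⁻¹e≈1 , _ = e ρ τ
          cancel : ∀ s → ι e⁻¹ * (ι s * (ι eρτ * r⁻¹ τ)) ≈ ι s * r⁻¹ τ
          cancel s = let open SetoidReasoning setoid in begin
            ι e⁻¹ * (ι s * (ι eρτ * r⁻¹ τ))
              ≈⟨ solve 4 (λ e′ s e r → e′ :* (s :* (e :* r)) := e′ :* e :* (s :* r)) refl _ _ _ _ ⟩
            ι e⁻¹ * ι eρτ * (ι s * r⁻¹ τ)
              ≈⟨ *-congʳ (trans (sym (*-homo _ _)) (trans (ι-cong e⁻¹e≈1) 1#-homo)) ⟩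
            1# * (ι s * r⁻¹ τ)                ≈⟨ *-identityˡ _ ⟩
            ι s * r⁻¹ τ                       ∎
      in ≃A-trans (≈⇒≃A (sym (cancel s)))
           (≃A-trans (≃A-*ₗ e⁻¹ ⟨ eventually ρ β<ρ ⟩A) (≈⇒≃A (cancel s′)))

    generator-annihilator : ∀ {τ s} → s *ₗ generator τ ≃ 0ᴹ → A.Member (ι s * r⁻¹ τ)
    generator-annihilator {τ} {s} sx≃0 = ≃0⇒∈A (≃A-trans
      (generator-cancel {τ} {s} {R.0#} (≃-trans sx≃0 (≃-*ₗ-zeroˡ (generator τ))))
      (≈⇒≃A (trans (*-congʳ 0#-homo) (zeroˡ _))))

    -- A record, so that f, σ and s can be inferred.
    record Generates (f : Germ) (σ : Ω) (s : R.Carrier) : Set ℓ where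
      constructor generates
      field equation : f ≃ s *ₗ generator σ

    raise : ∀ {f σ s τ} → σ ≤ τ → Generates f σ s → ∃[ s′ ] Generates f τ s′
    raise {s = s} {τ} σ≤τ (generates f≃sx) =
      let t , tr≈r = divisor σ≤τ
      in _ , generates (≃-trans f≃sx (≃-trans (≃-*ₗ s (generator-shift σ≤τ tr≈r))
               (≃-*ₗ-assoc s _ (generator τ))))

    commonGenerator : ∀ {f g σ τ s t} → Generates f σ s → Generates g τ t →
      ∃[ ρ ] ∃[ s′ ] ∃[ t′ ] (Generates f ρ s′ × Generates g ρ t′)
    commonGenerator {σ = σ} {τ} f-gen g-gen =
      let s′ , f-gen′ = raise (x≤x⊔y σ τ) f-gen
          t′ , g-gen′ = raise (x≤y⊔x σ τ) g-gen
      in σ ⊔ τ , s′ , t′ , f-gen′ , g-gen′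

    Generated : Submodule Germs
    Generated = record
      { Member    = λ f → ∃[ σ ] ∃[ s ] Generates f σ s
      ; resp      = λ f≈g (σ , s , generates f≃sx) →
          σ , s , generates (≃-trans (≃-sym (≈⇒≃ f≈g)) f≃sx)
      ; 0-closed  = ν , R.0# , generates (≃-*ₗ-zeroˡ (generator ν))
      ; +-closed  = λ (_ , _ , f-gen) (_ , _ , g-gen) →
          let ρ , s , t , generates f≃ , generates g≃ = commonGenerator f-gen g-gen
          in ρ , s R.+ t , generates (≃-trans (≃-+-cong f≃ g≃) (≃-*ₗ-distribʳ s t (generator ρ)))
      ; *ₗ-closed = λ r (σ , s , generates f≃sx) → σ , r R.* s ,
          generates (≃-trans (≃-*ₗ r f≃sx) (≃-*ₗ-assoc r s (generator σ)))
      }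

    U : Module R.commutativeRing ℓ ℓ
    U = Subquotient Germs Generated EventuallyA

    private module U = Module U

    multiple : ∀ {f g ρ s t} → Generates f ρ s → Generates g ρ t → s R.∣ t → ∃[ k ] k *ₗ f ≃ g
    multiple {f} {g} {ρ} {s} {t} (generates f≃sx) (generates g≃tx) (k Divisibility., ks≈t) =
      k , ≃-trans (≃-*ₗ k f≃sx)
      (≃-trans (≃-*ₗ-assoc k s (generator ρ)) (≃-trans (≃-*ₗ-cong ks≈t (generator ρ)) (≃-sym g≃tx)))

    -- Two elements are multiples of one generator, and total divisibility in R compares their
    -- coefficients.
    comparable : ∀ (x y : U.Carrierᴹ) →
                 (∃[ k ] k *ₗ proj₁ x ≃ proj₁ y) ⊎ (∃[ k ] k *ₗ proj₁ y ≃ proj₁ x)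
    comparable (_ , _ , _ , f-gen) (_ , _ , _ , g-gen) =
      let _ , s , t , f-gen′ , g-gen′ = commonGenerator f-gen g-gen
      in Sum.map (multiple f-gen′ g-gen′) (multiple g-gen′ f-gen′) (R.∣-total s t)

    multiple-closed : (X : Submodule U) → ∀ {x y : U.Carrierᴹ} {k} →
      k *ₗ proj₁ x ≃ proj₁ y → Member X x → Member X y
    multiple-closed X {x} {y} {k} kx≃y Xx =
      Submodule.resp X {k U.*ₗ x} {y} (difference kx≃y) (Submodule.*ₗ-closed X k {x} Xx)

    uniserial : Uniserial U
    uniserial X Y with em {P = Member X ⊆ Member Y}
    ... | yes X⊆Y = inj₁ X⊆Y
    ... | no  X⊈Y = inj₂ λ {y} Yy → decidable-stable em λ y∉X → X⊈Y λ {x} Xx →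
      [ (λ (k , kx≃y) → contradiction (multiple-closed X {x} {y} kx≃y Xx) y∉X)
      , (λ (k , ky≃x) → multiple-closed Y {y} {x} ky≃x Yy) ]′ (comparable x y)

    element : Ω → U.Carrierᴹ
    element σ = generator σ , σ , R.1# , generates (≃-*ₗ-identityˡ (generator σ))

    element-ν≄0 : ¬ generator ν ≃ 0ᴹ
    element-ν≄0 x≃0 = r⁻¹ν∉A (A.resp (trans (*-congʳ 1#-homo) (*-identityˡ _))
      (generator-annihilator {ν} {R.1#} (≃-trans (≃-sym (≃-*ₗ-identityˡ (generator ν))) x≃0)))

    -- The product of `s` and `r⁻¹ ν` is `d`, so the germ has the values `e ρ ν` times `d`.
    annihilates : ∀ {s d} → A.Member d → ι s ≈ ι (r ν) * d → s *ₗ generator ν ≃ 0ᴹ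
    annihilates {s} {d} Ad s≈rd = ∈⇒≃0 (ν , λ ρ _ → A.resp (begin
      ι (proj₁ (e ρ ν)) * d
        ≈⟨ trans (sym (*-identityʳ _)) (*-congˡ (sym (r*r⁻¹ ν))) ⟩
      ι (proj₁ (e ρ ν)) * d * (ι (r ν) * r⁻¹ ν)
        ≈⟨ solve 4 (λ e d r r′ → e :* d :* (r :* r′) := r :* d :* (e :* r′)) refl _ _ _ _ ⟩
      ι (r ν) * d * (ι (proj₁ (e ρ ν)) * r⁻¹ ν)       ≈⟨ *-congʳ s≈rd ⟨
      ι s * (ι (proj₁ (e ρ ν)) * r⁻¹ ν)               ∎) (A.*ₗ-closed (proj₁ (e ρ ν)) Ad))
      where open SetoidReasoning setoid

    -- Multiplied by `r ν`, the hypothesis says that p/t is congruent to the unit `u` modulo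
    -- `r ν A`. By the choice of ν, p/t is then itself a unit.
    unit-multiple : ∀ {μ u t p} → t R.* r ν R.≈ r μ → Unit R.commutativeRing u →
      ι p * r⁻¹ μ ≃A ι (u R.* t) * r⁻¹ μ → p R.∣ t
    unit-multiple {μ} {u} {t} {p} tr≈r u-unit p≃ut =
      let v , (v⁻¹ , v⁻¹v≈1 , _) , v≈ = unit-mod r⁻¹ν∉A u-unit rpr⁻¹≡u
      in v⁻¹ Divisibility., divides v⁻¹v≈1 v≈
      where
      open SetoidReasoning setoid
      rpr⁻¹≡u : ι (r ν) * (ι p * r⁻¹ μ) ≡ ι u [mod ν ]
      rpr⁻¹≡u = ≡-trans (≃A⇒≡ ν p≃ut) (≡-reflexive (begin
        ι (r ν) * (ι (u R.* t) * r⁻¹ μ)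
          ≈⟨ *-congˡ (trans (*-congʳ (*-homo u t)) (*-assoc _ _ _)) ⟩
        ι (r ν) * (ι u * (ι t * r⁻¹ μ))     ≈⟨ *-congˡ (*-congˡ (r⁻¹-shift tr≈r)) ⟩
        ι (r ν) * (ι u * r⁻¹ ν)
          ≈⟨ solve 3 (λ r e r′ → r :* (e :* r′) := r :* r′ :* e) refl _ _ _ ⟩
        ι (r ν) * r⁻¹ ν * ι u               ≈⟨ trans (*-congʳ (r*r⁻¹ ν)) (*-identityˡ _) ⟩
        ι u                                 ∎))
      divides : ∀ {v v⁻¹} → v⁻¹ R.* v R.≈ R.1# → ι v ≈ ι (r ν) * (ι p * r⁻¹ μ) → v⁻¹ R.* p R.≈ t
      divides {v} {v⁻¹} v⁻¹v≈1 v≈ = R.trans (R.*-congˡ (R.sym (ι-injective vt≈p)))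
        (R.trans (R.sym (R.*-assoc v⁻¹ v t)) (R.trans (R.*-congʳ v⁻¹v≈1) (R.*-identityˡ t)))
        where
        vt≈p : ι (v R.* t) ≈ ι p
        vt≈p = begin
          ι (v R.* t)                               ≈⟨ trans (*-homo v t) (*-congʳ v≈) ⟩
          ι (r ν) * (ι p * r⁻¹ μ) * ι t
            ≈⟨ solve 4 (λ r s r′ t → r :* (s :* r′) :* t := s :* (r :* (t :* r′))) refl _ _ _ _ ⟩
          ι p * (ι (r ν) * (ι t * r⁻¹ μ))
            ≈⟨ *-congˡ (trans (*-congˡ (r⁻¹-shift tr≈r)) (r*r⁻¹ ν)) ⟩
          ι p * 1#                                  ≈⟨ *-identityʳ _ ⟩
          ι p                                       ∎

    -- Written in terms of `generator μ`, both sides have comparable coefficients: `s′ s` on one, a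
    -- unit times `t` on the other. So even `s′ s` divides `t`. This bounds the divisors of
    -- `generator ν`.
    divides-generator : ∀ {f s s′ μ t} → ν ≤ μ → t R.* r ν R.≈ r μ → Generates f μ s′ →
      s *ₗ f ≃ generator ν → s R.∣ t
    divides-generator {f} {s} {s′} {μ} {t} ν≤μ tr≈r (generates f≃s′x) sf≃x =
      ∣-trans (s′ Divisibility., R.refl) 
        (unit-multiple tr≈r (proj₂ (e μ ν))
          (generator-cancel {μ} {s′ R.* s} {proj₁ (e μ ν) R.* t} s′sx≃etx))
      where
      open MonoidDivisibility R.*-monoid using () renaming (∣ʳ-trans to ∣-trans)
      open SetoidReasoning ≃-setoid
      s′sx≃etx : (s′ R.* s) *ₗ generator μ ≃ (proj₁ (e μ ν) R.* t) *ₗ generator μ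
      s′sx≃etx = begin
        (s′ R.* s) *ₗ generator μ                  ≈⟨ ≃-*ₗ-cong (R.*-comm s′ s) (generator μ) ⟩
        (s R.* s′) *ₗ generator μ                  ≈⟨ ≃-*ₗ-assoc s s′ (generator μ) ⟨
        s *ₗ (s′ *ₗ generator μ)                   ≈⟨ ≃-*ₗ s f≃s′x ⟨
        s *ₗ f                                     ≈⟨ sf≃x ⟩
        generator ν                                ≈⟨ generator-shift ν≤μ tr≈r ⟩
        (proj₁ (e μ ν) R.* t) *ₗ generator μ       ∎

    -- The type of the glued module, computed at `generator ν`

    module _ (J : QSubmodule) (J-exhausted : Member J ≐ λ q → ∃[ σ ] (r σ ⁻¹R) q) where
      private
        a = element ν
        module Ann = Submodule (Ann U a)
        open Modulo asModule (Ann U a) using ()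
          renaming (≈⇒≃ to ≈⇒≃Ann; difference to differenceAnn)

      -- If `q` is in `r τ ⁻¹R`, put μ = ν ⊔ τ. The quotient `t` of `r μ` by `r ν` divides
      -- `generator ν` by the shift rule, and `t` times `r ν q` is `r μ q`, which is integral.
      r*J⊆D : ∀ {q} → Member J q → Member (D U a) (ι (r ν) * q)
      r*J⊆D {q} Jq with proj₁ J-exhausted Jq
      ... | τ , s , s≈rq =
        let k , kr≈r  = divisor (x≤y⊔x ν τ)
            t , tr≈r  = divisor (x≤x⊔y ν τ)
        in t , (λ t≈0 → r≉0 (ν ⊔ τ) (R.trans (R.sym tr≈r) (R.trans (R.*-congʳ t≈0) (R.zeroˡ _))))
           , (proj₁ (e (ν ⊔ τ) ν) U.*ₗ element (ν ⊔ τ)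
             , difference (≃-sym (≃-trans (generator-shift (x≤x⊔y ν τ) tr≈r)
               (≃-trans (≃-*ₗ-cong (R.*-comm _ t) (generator (ν ⊔ τ)))
                 (≃-sym (≃-*ₗ-assoc t _ (generator (ν ⊔ τ))))))))
           , k R.* s , (begin
               ι (k R.* s)               ≈⟨ *-homo k s ⟩
               ι k * ι s                 ≈⟨ *-congˡ s≈rq ⟩
               ι k * (ι (r τ) * q)
                 ≈⟨ trans (sym (*-assoc _ _ _))
                     (*-congʳ (trans (sym (*-homo k (r τ))) (ι-cong (R.trans kr≈r (R.sym tr≈r))))) ⟩
               ι (t R.* r ν) * q         ≈⟨ trans (*-congʳ (*-homo t (r ν))) (*-assoc _ _ _) ⟩
               ι t * (ι (r ν) * q)       ∎)
        where open SetoidReasoning setoid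

      -- Members of the annihilator must be integral; were `r ν d` not integral, `r⁻¹ ν` would lie
      -- in `A`.
      A⇒Ann : ∀ {d} → A.Member d → Ann.Member (ι (r ν) * d)
      A⇒Ann {d} Ad with integral-or-inverse (ι (r ν) * d)
      ... | inj₁ (s , s≈rd) = s , difference (annihilates {s} {d} Ad s≈rd) , s≈rd
      ... | inj₂ (s , srd≈1) = contradiction (r⁻¹∈A ν s Ad srd≈1) r⁻¹ν∉A

      Ann⇒A : ∀ {d} → Ann.Member (ι (r ν) * d) → A.Member d
      Ann⇒A {d} (s , sx≃0 , s≈rd) = A.resp (begin
        ι s * r⁻¹ ν               ≈⟨ *-congʳ s≈rd ⟩
        ι (r ν) * d * r⁻¹ ν       ≈⟨ solve 3 (λ r d r′ → r :* d :* r′ := r :* r′ :* d) refl _ _ _ ⟩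
        ι (r ν) * r⁻¹ ν * d       ≈⟨ trans (*-congʳ (r*r⁻¹ ν)) (*-identityˡ d) ⟩
        d                         ∎) (generator-annihilator {ν} {s} ⟨ sx≃0 ⟩)
        where open SetoidReasoning setoid

      -- A divisor `s` of `generator ν` divides some quotient of `r μ` by `r ν`, which converts the
      -- denominator `s` of `y` into the denominator `r μ` of `r⁻¹ ν * y`.
      D⊆r*J : ∀ {y} → Member (D U a) y → Member J (r⁻¹ ν * y)
      D⊆r*J {y} (s , _ , ((f , τ , s₀ , f-gen) , sf≃a) , c , c≈sy) =
        let s′ , f-gen′ = raise (x≤y⊔x ν τ) f-gen
            t , tr≈r = divisor (x≤x⊔y ν τ)
        in proj₂ J-exhausted (ν ⊔ τ ,
          integral (divides-generator (x≤x⊔y ν τ) tr≈r f-gen′ ⟨ sf≃a ⟩) tr≈r)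
        where
        integral : ∀ {μ t} → s R.∣ t → t R.* r ν R.≈ r μ → (r μ ⁻¹R) (r⁻¹ ν * y)
        integral {μ} {t} (k Divisibility., ks≈t) tr≈r = k R.* c , (begin
          ι (k R.* c)                      ≈⟨ trans (*-homo k c) (*-congˡ c≈sy) ⟩
          ι k * (ι s * y)
            ≈⟨ trans (sym (*-assoc _ _ _)) (*-congʳ (trans (sym (*-homo k s)) (ι-cong ks≈t))) ⟩
          ι t * y
            ≈⟨ trans (*-congˡ (sym (*-identityˡ y))) (*-congˡ (*-congʳ (sym (r*r⁻¹ ν)))) ⟩
          ι t * (ι (r ν) * r⁻¹ ν * y)
            ≈⟨ solve 4 (λ t r r′ y → t :* (r :* r′ :* y) := t :* r :* (r′ :* y)) refl _ _ _ _ ⟩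
          ι t * ι (r ν) * (r⁻¹ ν * y)      ≈⟨ *-congʳ (trans (sym (*-homo t (r ν))) (ι-cong tr≈r)) ⟩
          ι (r μ) * (r⁻¹ ν * y)            ∎)
          where open SetoidReasoning setoid

      -- The isomorphism is multiplication by `r ν`, undone by `r⁻¹ ν`.
      hasType : HasType U J A
      hasType = a , (λ a≈0 → element-ν≄0 ⟨ a≈0 ⟩) , (λ (q , Jq) → ι (r ν) * q , r*J⊆D Jq) , record
        { isModuleMonomorphism = record
          { isModuleHomomorphism = record
            { isBimoduleHomomorphism = record
              { +ᴹ-isGroupHomomorphism = record
                { isMonoidHomomorphism = record
                  { isMagmaHomomorphism = record
                    { isRelHomomorphism = record { cong = λ {p} {q} → cong {p} {q} }
                    ; homo = λ _ _ → exact (distribˡ _ _ _)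
                    }
                  ; ε-homo = exact (zeroʳ _)
                  }
                ; ⁻¹-homo = λ _ → exact (sym (RingProperties.-‿distribʳ-* ring _ _))
                }
              ; *ₗ-homo = λ _ _ → exact (x∙yz≈y∙xz _ _ _)
              ; *ᵣ-homo = λ _ _ → exact (x∙yz≈y∙xz _ _ _)
              }
            }
          ; injective = λ φp≈φq → Ann⇒A (Ann.resp (sym (x[y-z]≈xy-xz _ _ _)) φp≈φq)
          }
        ; surjective = λ (y , Dy) → (r⁻¹ ν * y , D⊆r*J Dy) , λ {(z , Jz)} z≈ →
            Ann.resp (+-congˡ (-‿cong (r*r⁻¹y≈y y))) (cong {z , Jz} {r⁻¹ ν * y , D⊆r*J Dy} z≈)
        }
        where
        exact : ∀ {p q} → p ≈ q → Ann.Member (p - q)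
        exact p≈q = differenceAnn (≈⇒≃Ann p≈q)
        cong : ∀ {p q : ∃ (Member J)} → A.Member (proj₁ p - proj₁ q) →
               Ann.Member (ι (r ν) * proj₁ p - ι (r ν) * proj₁ q)
        cong p≈q = Ann.resp (x[y-z]≈xy-xz _ _ _) (A⇒Ann p≈q)
        r*r⁻¹y≈y : ∀ y → ι (r ν) * (r⁻¹ ν * y) ≈ y
        r*r⁻¹y≈y y = trans (sym (*-assoc _ _ _)) (trans (*-congʳ (r*r⁻¹ ν)) (*-identityˡ y))

    -- Isomorphisms onto standard modules trivialise the system of units

    module _ {J′ A′ : QSubmodule} (φ : U.Carrierᴹ → ∃ (Member J′))
      (φ-isIso : ModuleMorphisms.IsModuleIsomorphism U.rawModule
        (Module.rawModule (J′ / A′)) φ) where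
      private
        module A′ = Submodule A′
        module φ = ModuleMorphisms.IsModuleIsomorphism φ-isIso
      open Modulo asModule A′ using () renaming
        ( _≃_ to _≃′_; ⟨_⟩ to ⟨_⟩′; difference to difference′
        ; ≃-sym to ≃′-sym; ≃-trans to ≃′-trans; ∈⇒≃0 to ∈⇒≃′0 )

      image : Ω → Carrier
      image σ = proj₁ (φ (element σ))

      image-*ₗ : ∀ s σ → proj₁ (φ (s U.*ₗ element σ)) ≃′ ι s * image σ
      image-*ₗ s σ = ⟨ φ.*ₗ-homo s (element σ) ⟩′

      image-shift : ∀ {σ τ t} → σ ≤ τ → t R.* r σ R.≈ r τ →
                    image σ ≃′ ι (proj₁ (e τ σ) R.* t) * image τ
      image-shift {σ} {τ} {t} σ≤τ tr≈r = ≃′-trans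
        ⟨ φ.⟦⟧-cong {element σ} {(proj₁ (e τ σ) R.* t) U.*ₗ element τ}
          (difference (generator-shift σ≤τ tr≈r)) ⟩′
        (image-*ₗ _ τ)

      image-annihilator : ∀ s → A′.Member (ι s * image ν) → s *ₗ generator ν ≃ 0ᴹ
      image-annihilator s A′sy = ⟨ φ.injective {s U.*ₗ element ν} {U.0ᴹ} (difference′
        (≃′-trans (image-*ₗ s ν) (≃′-trans (∈⇒≃′0 A′sy) (≃′-sym ⟨ φ.0ᴹ-homo ⟩′)))) ⟩

      image-ν∉A′ : ¬ A′.Member (image ν)
      image-ν∉A′ A′y = element-ν≄0 (≃-trans (≃-*ₗ-identityˡ (generator ν))
        (image-annihilator R.1# (A′.*ₗ-closed R.1# A′y)))

      image-ν-invertible : ∃[ y⁻¹ ] (y⁻¹ * image ν ≈ 1# × image ν * y⁻¹ ≈ 1#)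
      image-ν-invertible = IsField.invertible isField (image ν)
        λ y≈0 → image-ν∉A′ (A′.resp (sym y≈0) A′.0-closed)

      -- Multiplication by scale carries image ν to r⁻¹ ν and A′ into A.
      scale : Carrier
      scale = r⁻¹ ν * proj₁ image-ν-invertible

      -- Compare `p` with `image ν`. If `p` is an integral multiple `s` of it, then `s` kills
      -- `image ν` modulo `A′`, hence kills `generator ν` by injectivity. If instead `image ν` is a
      -- multiple of `p`, it lies in `A′`, which is impossible.
      scale-A′ : ∀ {p} → A′.Member p → A.Member (p * scale)
      scale-A′ {p} A′p = let y⁻¹ , y⁻¹y≈1 , _ = image-ν-invertible in
        [ (λ (s , s≈py⁻¹) → A.resp (begin
            ι s * r⁻¹ ν           ≈⟨ *-congʳ s≈py⁻¹ ⟩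
            p * y⁻¹ * r⁻¹ ν
              ≈⟨ solve 3 (λ p y′ r′ → p :* y′ :* r′ := p :* (r′ :* y′)) refl _ _ _ ⟩
            p * (r⁻¹ ν * y⁻¹)     ∎)
            (generator-annihilator {ν} {s} (image-annihilator s (A′.resp (begin
              p                     ≈⟨ trans (sym (*-identityʳ p)) (*-congˡ (sym y⁻¹y≈1)) ⟩
              p * (y⁻¹ * image ν)   ≈⟨ trans (sym (*-assoc _ _ _)) (*-congʳ (sym s≈py⁻¹)) ⟩
              ι s * image ν         ∎) A′p))))
        , (λ (s , spy⁻¹≈1) → contradiction (A′.resp (begin
            ι s * p                         ≈⟨ trans (sym (*-identityʳ _)) (*-congˡ (sym y⁻¹y≈1)) ⟩
            ι s * p * (y⁻¹ * image ν)
              ≈⟨ solve 4 (λ s p y′ y → s :* p :* (y′ :* y) := s :* (p :* y′) :* y) refl _ _ _ _ ⟩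
            ι s * (p * y⁻¹) * image ν       ≈⟨ trans (*-congʳ spy⁻¹≈1) (*-identityˡ _) ⟩
            image ν                         ∎) (A′.*ₗ-closed s A′p)) image-ν∉A′)
        ]′ (integral-or-inverse (p * y⁻¹))
        where open SetoidReasoning setoid

      -- The factor by which the rescaled image of `generator σ` differs from `r⁻¹ σ`; the scaling
      -- makes it 1 at ν.
      coefficient : Ω → Carrier
      coefficient σ = ι (r σ) * (image σ * scale)

      coefficient-ν : coefficient ν ≈ 1#
      coefficient-ν = let y⁻¹ , _ , yy⁻¹≈1 = image-ν-invertible in begin
        ι (r ν) * (image ν * (r⁻¹ ν * y⁻¹))
          ≈⟨ solve 4 (λ r y r′ y′ → r :* (y :* (r′ :* y′)) := r :* r′ :* (y :* y′)) refl _ _ _ _ ⟩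
        ι (r ν) * r⁻¹ ν * (image ν * y⁻¹)
          ≈⟨ trans (*-cong (r*r⁻¹ ν) yy⁻¹≈1) (*-identityˡ 1#) ⟩
        1#                                      ∎
        where open SetoidReasoning setoid

      -- The shift rule holds among the images modulo `A′`; `scale` carries it into Q modulo `A`,
      -- and multiplication by `r σ` gives the congruence.
      coefficient-coherent : ∀ {σ τ} → σ ≤ τ
                           → coefficient σ ≡ ι (proj₁ (e τ σ)) * coefficient τ [mod σ ]
      coefficient-coherent {σ} {τ} σ≤τ = shifted (divisor σ≤τ)
        where
        open SetoidReasoning setoid
        shifted : ∃[ t ] t R.* r σ R.≈ r τ
                → coefficient σ ≡ ι (proj₁ (e τ σ)) * coefficient τ [mod σ ]
        shifted (t , tr≈r) = ≡-trans
          (≃A⇒≡ σ ⟨ A.resp ([y-z]x≈yx-zx _ _ _) (scale-A′ (difference′ (image-shift σ≤τ tr≈r))) ⟩A)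
          (≡-reflexive (begin
            ι (r σ) * (ι (proj₁ (e τ σ) R.* t) * image τ * scale)
              ≈⟨ *-congˡ (*-congʳ (*-congʳ (*-homo _ t))) ⟩
            ι (r σ) * (ι (proj₁ (e τ σ)) * ι t * image τ * scale)
              ≈⟨ solve 5 (λ r e t y z → r :* (e :* t :* y :* z) := e :* (t :* r :* (y :* z))) 
                   refl _ _ _ _ _ ⟩
            ι (proj₁ (e τ σ)) * (ι t * ι (r σ) * (image τ * scale))
              ≈⟨ *-congˡ (*-congʳ (trans (sym (*-homo t (r σ))) (ι-cong tr≈r))) ⟩
            ι (proj₁ (e τ σ)) * coefficient τ                             ∎))

      -- Its product with the unit `e τ ν` is congruent to `coefficient ν`, that is to 1, modulo
      -- `r ν A`, so `unit-mod` applies.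
      coefficient-unit : ∀ {τ} → ν ≤ τ → ∃[ f ] (Unit R.commutativeRing f × ι f ≈ coefficient τ)
      coefficient-unit {τ} ν≤τ =
        let eτν , eτν-unit = e τ ν
            e⁻¹ , e⁻¹e≈1 , _ = eτν-unit
            v , v-unit , v≈ = unit-mod r⁻¹ν∉A {R.1#} (R.1# , R.*-identityˡ _ , R.*-identityˡ _)
              (≡-trans (≡-sym (coefficient-coherent ν≤τ))
                       (≡-reflexive (trans coefficient-ν (sym 1#-homo))))
        in e⁻¹ R.* v , proj₂ ((eτν , eτν-unit) G.⁻¹ G.∙ (v , v-unit)) , (begin
          ι (e⁻¹ R.* v)                         ≈⟨ trans (*-homo e⁻¹ v) (*-congˡ v≈) ⟩
          ι e⁻¹ * (ι eτν * coefficient τ)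
            ≈⟨ trans (sym (*-assoc _ _ _)) (*-congʳ (trans (sym (*-homo _ _)) (ι-cong e⁻¹e≈1))) ⟩
          ι R.1# * coefficient τ                ≈⟨ trans (*-congʳ 1#-homo) (*-identityˡ _) ⟩
          coefficient τ                         ∎)
        where open SetoidReasoning setoid

      -- The unit `f` represents `coefficient δ`, and both sides are congruent to `coefficient σ`.
      -- For σ below ν that coefficient is not known to be integral, so `g σ` is defined by way of σ
      -- ⊔ ν.
      iso⇒coboundary : Σ[ g ∈ (Ω → R.Carrier) ] ∀ {δ} → ν ≤ δ → ∃[ f ]
        (Unit R.commutativeRing f × ∀ {σ} → σ ≤ δ → ι (proj₁ (e δ σ) R.* f) ≡ ι (g σ) [mod σ ])
      iso⇒coboundary = (λ σ → proj₁ (e (σ ⊔ ν) σ) R.* proj₁ (coefficient-unit (x≤y⊔x σ ν)))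
        , λ ν≤δ → let f , f-unit , f≈ = coefficient-unit ν≤δ in f , f-unit , λ σ≤δ →
            agree σ≤δ ν≤δ f≈ (proj₂ (proj₂ (coefficient-unit (x≤y⊔x _ ν))))
        where
        agree : ∀ {σ δ f f′} → σ ≤ δ → ν ≤ δ → ι f ≈ coefficient δ → ι f′ ≈ coefficient (σ ⊔ ν) →
                ι (proj₁ (e δ σ) R.* f) ≡ ι (proj₁ (e (σ ⊔ ν) σ) R.* f′) [mod σ ]
        agree {σ} {δ} {f} {f′} σ≤δ ν≤δ f≈ f′≈ = begin
          ι (proj₁ (e δ σ) R.* f)
            ≈⟨ ≡-ι-*-cong (e-coherent δ (x≤x⊔y σ ν) μ≤δ) (≡-reflexive refl) ⟩
          ι (proj₁ (e δ (σ ⊔ ν)) R.* proj₁ (e (σ ⊔ ν) σ) R.* f)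
            ≈⟨ ≡-reflexive (trans (*-homo _ f) (*-cong (*-homo _ _) f≈)) ⟩
          ι (proj₁ (e δ (σ ⊔ ν))) * ι (proj₁ (e (σ ⊔ ν) σ)) * coefficient δ
            ≈⟨ ≡-reflexive (solve 3 (λ x y c → x :* y :* c := y :* (x :* c)) refl _ _ _) ⟩
          ι (proj₁ (e (σ ⊔ ν) σ)) * (ι (proj₁ (e δ (σ ⊔ ν))) * coefficient δ)
            ≈⟨ ≡-*ₗ _ (≡-antitone-≤ (x≤x⊔y σ ν) (coefficient-coherent μ≤δ)) ⟨
          ι (proj₁ (e (σ ⊔ ν) σ)) * coefficient (σ ⊔ ν)
            ≈⟨ ≡-reflexive (trans (*-homo _ f′) (*-congˡ f′≈)) ⟨
          ι (proj₁ (e (σ ⊔ ν) σ) R.* f′)                              ∎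
          where
          open SetoidReasoning (≡-setoid σ)
          μ≤δ = ⊔-lub σ≤δ ν≤δ
          ≡-antitone-≤ : ∀ {σ τ} → σ ≤ τ → ∀ {p q} → p ≡ q [mod τ ] → p ≡ q [mod σ ]
          ≡-antitone-≤ (inj₁ σ<τ)    p≡q = ≡-antitone σ<τ p≡q
          ≡-antitone-≤ (inj₂ ≡.refl) p≡q = p≡q

theorem7 : (∀ {a} → ExcludedMiddle a) →
    ∀ {ℓ} (ω₁ : Omega₁ ℓ) (V : ValuationDomain ℓ) (Q : QuotientField V) →
    let open Types V Q
        open Gamma ω₁ V Q
    in
    ¬ (∀ q → QuotientField.IsIntegral Q q) →
    Bijection (Omega₁.setoid ω₁) (ValuationDomain.setoid V) →
    (J A : QSubmodule) → Member A ⊆ Member J →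
    (r : Omega₁.Carrier ω₁ → ValuationDomain.Carrier V) → IsChainFor J r →
    (N : Omega₁.Carrier ω₁ → Pred (ValuationDomain.Carrier V) ℓ) → IsFiltration r N →
    Γ′≢0 A r N →
    Σ[ M ∈ Module (ValuationDomain.commutativeRing V) ℓ ℓ ] (NonStandardUniserial M × HasType M J A)
theorem7 em {ℓ} ω₁ V Q _ _ J A _ r chain N filtration E′-stationary =
  U
  , (uniserial , λ (J′ , A′ , _ , φ , φ-isIso) →
      not-coboundary (iso⇒coboundary {J′} {A′} φ φ-isIso))
  , hasType J exhausts
  where
  module R = ValuationDomain V
  open Gamma ω₁ V Q
  open IsChainFor chain renaming (increasing to r-increasing)
  module N = IsFiltration filtration
  open Omega₁ ω₁ using (_<_) renaming (Carrier to Ω)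
  open Ordinals em ω₁
  open Congruence ω₁ V Q A r nonzero r-increasing
  open TwistingUnits em ω₁ V Q A r nonzero r-increasing N filtration

  -- At one point of `E′` some `u σ` is not captured, whereas everything would be captured if
  -- `r σ A` contained R. The cub of closure points of the identity is all of ω₁, so it merely
  -- provides a point of `E′`.
  nontrivialLevel : ∃[ ν ] ¬ Member A (r⁻¹ ν)
  nontrivialLevel =
    let δ , (_ , u , _ , u-escapes) , _ =
          stationary {E = E′ A r N} E′-stationary (closureCub λ σ → σ)
        σ , _ , u∉ = u-escapes R.1# (R.1# , R.*-identityˡ _ , R.*-identityˡ _)
    in σ , λ Ar⁻¹ → u∉ (∈N⇒+Scaled (r⁻¹∈A⇒∈N {δ} Ar⁻¹ (u σ R.* R.1#)))

  ν : Ω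
  ν = proj₁ nontrivialLevel

  open GermModule.Glued em ω₁ V Q A r nonzero r-increasing e e-coherent ν (proj₂ nontrivialLevel)

  not-coboundary : ¬ (Σ[ g ∈ (Ω → R.Carrier) ] ∀ {δ} → ν ≤ δ → ∃[ f ]
    (Unit R.commutativeRing f × ∀ {σ} → σ ≤ δ →
      QuotientField.ι Q (proj₁ (e δ σ) R.* f) ≡ QuotientField.ι Q (g σ) [mod σ ]))
  not-coboundary (g , coboundary) =
    -- At closure points δ of `h` every `g σ` with σ below δ lies in `N δ`; joining with ν forces δ
    -- above ν.
    let h = λ σ → proj₁ (N.exhausts (g σ)) ⊔ ν
        δ , δ∈E′@(((σ₀ , σ₀<δ) , _) , _) , h<δ =
          stationary {E = E′ A r N} E′-stationary (closureCub h)
        f , f-unit , ef≡g = coboundary (inj₁ (≤-<-trans (x≤y⊔x _ ν) (h<δ σ₀ σ₀<δ)))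
    -- The values `g σ` now represent `e δ σ · f` inside `N δ`, so `f` captures the row `e δ`.
    in e-escapes δ δ∈E′ (f , f-unit , λ σ σ<δ →
         g σ , N.increasing (≤-<-trans (x≤x⊔y _ ν) (h<δ σ σ<δ)) (proj₂ (N.exhausts (g σ)))
         , ef≡g (inj₁ σ<δ))
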